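{- Let $k\ge 2$ be an integer and let $\delta$ be a fixed positive real number. There is a constant $C=C(\delta,k)>0$ such that the following holds: if $r=r(n)$ satisfies $C n^{1-1/k}\le r\le n$, and $R$ is a subset of $[n]=\{1,\dots,n\}$ chosen uniformly at random among all subsets of cardinality $r$, then the probability that $R$ is $(\delta,(a,a+d^k))$-dense tends to $1$ as $n\to\infty$. That is, with probability $1-o(1)$, every subset $A\subseteq R$ with $|A|\ge \delta |R|$ contains two elements $a$ and $a+d^k$ for some positive integer $d$.
   Context: For a set $A$ of integers and $\delta>0$, $A$ is called $(\delta,(a,a+d^k))$-dense if every subset of $A$ of cardinality at least $\delta|A|$ contains a nontrivial instance of the configuration $(a,a+d^k)$, i.e. two elements $a$ and $a+d^k$ with $d$ a positive integer. "Almost every subset of size $r\gg_\delta n^{1-1/k}$" means: for $r$ at least a sufficiently large constant (depending on $\delta$ and $k$) times $n^{1-1/k}$, the proportion of $r$-element subsets of $[n]$ with the property tends to $1$ as $n\to\infty$. -}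

module Defs where

open import Data.Nat using (ℕ; zero; suc; _+_; _*_; _^_; _≤_; _≥_)
open import Data.Fin using (Fin; toℕ)
open import Data.Fin.Subset using (Subset; _∈_; _⊆_; ∣_∣)
open import Data.Product using (Σ; ∃; _×_)
open import Data.List using (List; length)
open import Data.List.Relation.Unary.All using (All)
open import Data.List.Relation.Unary.Unique.Propositional using (Unique)
open import Data.Nat.Combinatorics using (_C_)
open import Relation.Binary.PropositionalEquality using (_≡_)

-- A subset of [n] = {1,…,n} is represented as a Subset n; Fin element i
-- stands for the integer i+1 (so differences are the same as toℕ differences).

HasPowerPair : ∀ {n} → ℕ → Subset n → Set
HasPowerPair {n} k A =
  Σ (Fin n) λ i → Σ (Fin n) λ j → Σ ℕ λ d →
    (d ≥ 1) × (i ∈ A) × (j ∈ A) × (toℕ j ≡ toℕ i + d ^ k)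

-- R is (δ,(a,a+d^k))-dense with δ = p/q: every A ⊆ R with |A| ≥ (p/q)|R|
-- (i.e. q|A| ≥ p|R|) contains a nontrivial (a, a+d^k).
Dense : ∀ {n} → ℕ → ℕ → ℕ → Subset n → Set
Dense {n} k p q R = (A : Subset n) → A ⊆ R → q * ∣ A ∣ ≥ p * ∣ R ∣ → HasPowerPair k A

-- "At least a (1 - 1/(m+1)) proportion of the r-subsets of [n] are dense":
-- there is a duplicate-free list of dense r-subsets of [n] whose length L
-- satisfies (m+1)·L ≥ m·binom(n,r).
MostDense : ℕ → ℕ → ℕ → ℕ → ℕ → ℕ → Set
MostDense k p q n r m =
  ∃ λ (L : List (Subset n)) →
    Unique L × All (λ R → (∣ R ∣ ≡ r) × Dense k p q R) L
      × (m * (n C r) ≤ suc m * length L)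

{-# OPTIONS --safe #-}

-- Density theorem.  Suppose a set of density δ has no differences d^k while
-- sets of density δ + η must have one.  On progressions of step s^k it then has
-- density at most δ + η, hence almost exactly that on most of them.  Van der
-- Corput's inequality with bounded shifts lowers the degree of d ↦ d^k one at a
-- time, so f - (δ + η) also averages to almost 0 along x + d^k for most x, which
-- is absurd for x in the set.  Finitely many steps of size η descend from
-- density 1 to any given density.
--
-- Supersaturation.  Applied to the progressions x + D^k t for all D up to a
-- constant times n^(1/k), the density theorem yields, in every dense subset U
-- of [n], a point x with at least β ≈ n^(1/k) elements x + d^k in U.
--
-- Sparse sets.  Branching on such points, as in Kleitman and Winston, bounds the
-- number of power-difference-free t-subsets of [n] by 16^r (n/(A r))^t, where A
-- is as large as we like, once r β ≥ 2 A n.  At most a fraction (r/n)^t of the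
-- r-subsets contains a given t-set, so with t ≥ r/q and A = 32^q a fraction of
-- at most 2^(-r) of all r-subsets contains a power-difference-free t-set.

module Submission where

-- Mean squares over ℤ/M are compared with denominators cleared: a bound K/E appears as a factor `E`
-- on the other side. The descent stops only because η = 1/Q can be fixed before it starts: the
-- precision needed on progressions depends on the degree and on the precision wanted, never on the
-- length N′ found at the denser level. Boundedly many shifts matter because each differencing then
-- yields finitely many polynomials, which share one averaging length. The steps s^k are forced,
-- since d^k inside such a progression is (s d)^k outside. It also matters that the density bound is
-- one-sided: it holds on every progression, so the mean of the defect controls its mean square. In
-- the supersaturation step one difference (D e)^k may come from many pairs (D, e), so e is fixed by
-- pigeonhole before the elements x + (D e)^k are counted. Constants: 4 replaces the base e in (1 +
-- x/y)^y ≤ e^x, which is used for y = n and for y = ⌊n/A⌋, whence 16 = 4 · 4; and 32 = 2 · 16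
-- leaves a gain of 2^r.

module IntegerSums where

  open import Data.Nat using (ℕ; zero; suc; z≤n)
  import Data.Nat as ℕ
  import Data.Nat.Properties as ℕₚ
  open import Data.Integer using (ℤ; +_; -[1+_]; 0ℤ; 1ℤ; -_; _+_; _*_; _-_; _≤_; _<_; +≤+; nonNegative; positive)
  open import Data.Integer.Properties
  open import Data.Integer.Tactic.RingSolver using (solve-∀)
  open import Relation.Nullary using (yes; no)
  open import Relation.Binary.PropositionalEquality

  -- Reduces a nonlinear inequality to a ring identity with an explicit nonnegative remainder `e`,
  -- which the ring solver can check.
  ≤-by : ∀ {a b} e → 0ℤ ≤ e → b ≡ a + e → a ≤ b
  ≤-by {a} e 0≤e refl = subst (_≤ a + e) (+-identityʳ a) (+-monoʳ-≤ a 0≤e)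

  *-nonneg : ∀ {a b} → 0ℤ ≤ a → 0ℤ ≤ b → 0ℤ ≤ a * b
  *-nonneg {+ m} {+ n} _ _ = subst (0ℤ ≤_) (pos-* m n) (+≤+ z≤n)

  +-nonneg : ∀ {a b} → 0ℤ ≤ a → 0ℤ ≤ b → 0ℤ ≤ a + b
  +-nonneg p q = +-mono-≤ p q

  sq-nonneg : ∀ a → 0ℤ ≤ a * a
  sq-nonneg (+ n)    = *-nonneg {+ n} {+ n} (+≤+ z≤n) (+≤+ z≤n)
  sq-nonneg -[1+ n ] = +≤+ z≤n

  diff-nonneg : ∀ {a b} → a ≤ b → 0ℤ ≤ b - a
  diff-nonneg = i≤j⇒0≤j-i

  *-monoˡ : ∀ {a b c} → 0ℤ ≤ c → a ≤ b → c * a ≤ c * b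
  *-monoˡ {a} {b} {c} 0≤c a≤b = *-monoˡ-≤-nonNeg c {{nonNegative 0≤c}} a≤b

  *-cancelˡ : ∀ {a b} c → 0ℤ < c → c * a ≤ c * b → a ≤ b
  *-cancelˡ {a} {b} c 0<c = *-cancelˡ-≤-pos a b c {{positive 0<c}}

  pos-nonneg : ∀ {n} → 0ℤ ≤ + n
  pos-nonneg = +≤+ z≤n

  sq-cancel-≤ : ∀ {x y} → 0ℤ ≤ y → x * x ≤ y * y → x ≤ y
  sq-cancel-≤ {x} {y} 0≤y x²≤y² = ≮⇒≥ (λ y<x → <⇒≱ (≤-<-trans (*-monoˡ 0≤y (<⇒≤ y<x))
    (*-monoʳ-<-pos x {{positive (≤-<-trans 0≤y y<x)}} y<x)) x²≤y²)

  -- Finite sums, periodic functions and Cauchy-Schwarz over ℤ.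

  ∑ : ℕ → (ℕ → ℤ) → ℤ
  ∑ zero    f = 0ℤ
  ∑ (suc n) f = ∑ n f + f n

  ∑-cong : ∀ n {f g} → (∀ i → f i ≡ g i) → ∑ n f ≡ ∑ n g
  ∑-cong zero    e = refl
  ∑-cong (suc n) e = cong₂ _+_ (∑-cong n e) (e n)

  ∑-mono< : ∀ n {f g} → (∀ i → i ℕ.< n → f i ≤ g i) → ∑ n f ≤ ∑ n g
  ∑-mono< zero    e = ≤-refl
  ∑-mono< (suc n) e = +-mono-≤ (∑-mono< n (λ i i<n → e i (ℕₚ.m<n⇒m<1+n i<n))) (e n ℕₚ.≤-refl)

  ∑-mono : ∀ n {f g} → (∀ i → f i ≤ g i) → ∑ n f ≤ ∑ n g
  ∑-mono n e = ∑-mono< n (λ i _ → e i)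

  ∑-cong< : ∀ n {f g} → (∀ i → i ℕ.< n → f i ≡ g i) → ∑ n f ≡ ∑ n g
  ∑-cong< zero    e = refl
  ∑-cong< (suc n) e = cong₂ _+_ (∑-cong< n (λ i i<n → e i (ℕₚ.m<n⇒m<1+n i<n))) (e n ℕₚ.≤-refl)

  ∑-+ : ∀ n f g → ∑ n (λ i → f i + g i) ≡ ∑ n f + ∑ n g
  ∑-+ zero    f g = refl
  ∑-+ (suc n) f g = trans (cong (_+ (f n + g n)) (∑-+ n f g)) (rearr (∑ n f) (∑ n g) (f n) (g n))
    where
    rearr : ∀ a b c d → (a + b) + (c + d) ≡ (a + c) + (b + d)
    rearr = solve-∀

  ∑-*ˡ : ∀ n c f → ∑ n (λ i → c * f i) ≡ c * ∑ n f
  ∑-*ˡ zero    c f = sym (*-zeroʳ c)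
  ∑-*ˡ (suc n) c f = trans (cong (_+ c * f n) (∑-*ˡ n c f)) (sym (*-distribˡ-+ c (∑ n f) (f n)))

  ∑-*ʳ : ∀ n c f → ∑ n (λ i → f i * c) ≡ ∑ n f * c
  ∑-*ʳ n c f = trans (∑-cong n (λ i → *-comm (f i) c)) (trans (∑-*ˡ n c f) (*-comm c (∑ n f)))

  ∑-const : ∀ n c → ∑ n (λ _ → c) ≡ + n * c
  ∑-const zero    c = sym (*-zeroˡ c)
  ∑-const (suc n) c = trans (cong (_+ c) (∑-const n c)) (trans (rearr (+ n) c) (cong (_* c) (sym (pos-+ 1 n))))
    where
    rearr : ∀ a c → a * c + c ≡ (1ℤ + a) * c
    rearr = solve-∀

  ∑-zero : ∀ n → ∑ n (λ _ → 0ℤ) ≡ 0ℤ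
  ∑-zero n = trans (∑-const n 0ℤ) (*-zeroʳ (+ n))

  ∑-nonneg : ∀ n {f} → (∀ i → 0ℤ ≤ f i) → 0ℤ ≤ ∑ n f
  ∑-nonneg n p = subst (_≤ ∑ n _) (∑-zero n) (∑-mono n p)

  ∑-swap : ∀ m n (f : ℕ → ℕ → ℤ) → ∑ m (λ i → ∑ n (f i)) ≡ ∑ n (λ j → ∑ m (λ i → f i j))
  ∑-swap zero    n f = sym (∑-zero n)
  ∑-swap (suc m) n f = trans (cong (_+ ∑ n (f m)) (∑-swap m n f))
                             (sym (∑-+ n (λ j → ∑ m (λ i → f i j)) (f m)))

  ∑-++ : ∀ m n f → ∑ (n ℕ.+ m) f ≡ ∑ m f + ∑ n (λ i → f (i ℕ.+ m))
  ∑-++ m zero    f = sym (+-identityʳ (∑ m f))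
  ∑-++ m (suc n) f = trans (cong (_+ f (n ℕ.+ m)) (∑-++ m n f)) (+-assoc (∑ m f) _ _)

  ∑-block : ∀ T H f → ∑ (T ℕ.* H) f ≡ ∑ T (λ t → ∑ H (λ h → f (h ℕ.+ t ℕ.* H)))
  ∑-block zero    H f = refl
  ∑-block (suc T) H f = trans (∑-++ (T ℕ.* H) H f) (cong (_+ ∑ H (λ h → f (h ℕ.+ T ℕ.* H))) (∑-block T H f))

  ∑-head : ∀ n f → ∑ (suc n) f ≡ f 0 + ∑ n (λ i → f (suc i))
  ∑-head zero    f = trans (+-identityˡ (f 0)) (sym (+-identityʳ (f 0)))
  ∑-head (suc n) f = trans (cong (_+ f (suc n)) (∑-head n f)) (+-assoc (f 0) _ _)

  ∑-term : ∀ n {f} → (∀ i → 0ℤ ≤ f i) → ∀ {i} → i ℕ.< n → f i ≤ ∑ n f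
  ∑-term (suc n) {f} 0≤f {i} i<1+n with i ℕ.≟ n
  ... | yes refl = ≤-by (∑ n f) (∑-nonneg n 0≤f) (+-comm (∑ n f) (f n))
  ... | no i≢n   = ≤-trans (∑-term n 0≤f (ℕₚ.≤∧≢⇒< (ℕₚ.≤-pred i<1+n) i≢n)) (≤-by (f n) (0≤f n) refl)

  -- Functions on ℤ/M are kept as functions on ℕ, so that translation is plain addition.
  Periodic : ℕ → (ℕ → ℤ) → Set
  Periodic M F = ∀ x → F (x ℕ.+ M) ≡ F x

  -- A shift by one loses the term `G 0` and gains `G M`, which are equal by periodicity.
  ∑-shift : ∀ {M F} → Periodic M F → ∀ c → ∑ M (λ x → F (x ℕ.+ c)) ≡ ∑ M F
  ∑-shift {M} {F} per zero    = ∑-cong M (λ x → cong F (ℕₚ.+-identityʳ x))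
  ∑-shift {M} {F} per (suc c) = trans step (∑-shift per c)
    where
    G : ℕ → ℤ
    G x = F (x ℕ.+ c)
    cycle : G M ≡ G 0
    cycle = trans (cong F (ℕₚ.+-comm M c)) (per c)
    rearr : ∀ a b → b ≡ (a + b) - a
    rearr = solve-∀
    cancel : ∀ a b → (a + b) - b ≡ a
    cancel = solve-∀
    step : ∑ M (λ x → F (x ℕ.+ suc c)) ≡ ∑ M G
    step = trans (∑-cong M (λ x → cong F (ℕₚ.+-suc x c)))
           (trans (rearr (G 0) (∑ M (λ x → G (suc x))))
           (trans (cong₂ _-_ (sym (∑-head M G)) (sym cycle)) (cancel (∑ M G) (G M))))

  -- Induction on `n`. New terms a, b require 2Pab ≤ Ab² + Ba², which follows from P² ≤ AB: the
  -- squares of the two sides differ by (Ab² - Ba²)² + 4(ab)²(AB - P²).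
  Cauchy-Schwarz : ∀ n (f g : ℕ → ℤ) → ∑ n (λ i → f i * g i) * ∑ n (λ i → f i * g i) ≤ ∑ n (λ i → f i * f i) * ∑ n (λ i → g i * g i)
  Cauchy-Schwarz zero    f g = ≤-refl
  Cauchy-Schwarz (suc n) f g = ≤-by _ (+-nonneg (diff-nonneg ih) (diff-nonneg cross)) (final P A B a b)
    where
    P = ∑ n (λ i → f i * g i)
    A = ∑ n (λ i → f i * f i)
    B = ∑ n (λ i → g i * g i)
    a = f n
    b = g n
    ih : P * P ≤ A * B
    ih = Cauchy-Schwarz n f g
    X = P * (a * b) + P * (a * b)
    Y = A * (b * b) + B * (a * a)
    identity : ∀ P A B a b → (A * (b * b) + B * (a * a)) * (A * (b * b) + B * (a * a))
      ≡ (P * (a * b) + P * (a * b)) * (P * (a * b) + P * (a * b))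
        + ((A * (b * b) - B * (a * a)) * (A * (b * b) - B * (a * a)) + (+ 4) * ((a * b) * (a * b) * (A * B - P * P)))
    identity = solve-∀
    cross : X ≤ Y
    cross = sq-cancel-≤
      (+-nonneg (*-nonneg (∑-nonneg n (λ i → sq-nonneg (f i))) (sq-nonneg b))
                (*-nonneg (∑-nonneg n (λ i → sq-nonneg (g i))) (sq-nonneg a)))
      (≤-by _ (+-nonneg (sq-nonneg (A * (b * b) - B * (a * a)))
                (*-nonneg {+ 4} pos-nonneg (*-nonneg (sq-nonneg (a * b)) (diff-nonneg ih))))
              (identity P A B a b))
    final : ∀ P A B a b → (A + a * a) * (B + b * b)
      ≡ (P + a * b) * (P + a * b)
        + ((A * B - P * P) + ((A * (b * b) + B * (a * a)) - (P * (a * b) + P * (a * b))))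
    final = solve-∀

  sq-∑-≤ : ∀ n (f : ℕ → ℤ) → ∑ n f * ∑ n f ≤ + n * ∑ n (λ i → f i * f i)
  sq-∑-≤ n f = subst₂ _≤_ (cong₂ _*_ e e)
                   (trans (*-comm (∑ n (λ i → f i * f i)) (∑ n (λ _ → 1ℤ))) (cong (_* ∑ n (λ i → f i * f i)) (trans (∑-const n 1ℤ) (*-identityʳ (+ n)))))
                   (Cauchy-Schwarz n f (λ _ → 1ℤ))
    where
    e : ∑ n (λ i → f i * 1ℤ) ≡ ∑ n f
    e = ∑-cong n (λ i → *-identityʳ (f i))

  ∑-sq : ∀ n (f : ℕ → ℤ) → ∑ n f * ∑ n f ≡ ∑ n (λ i → ∑ n (λ j → f i * f j))
  ∑-sq n f = trans (sym (∑-*ʳ n (∑ n f) f)) (∑-cong n (λ i → sym (∑-*ˡ n (f i) f)))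

-- Polynomials with positive leading coefficient and their differences.

module Polynomials where

  open import Data.Nat using (ℕ; zero; suc; _+_; _*_; _^_)
  open import Data.Nat.Properties
  open import Data.Nat.Tactic.RingSolver using (solve-∀)
  open import Data.Product using (Σ; _,_)
  open import Relation.Binary.PropositionalEquality

  -- Polynomial expressions of exact degree k with natural coefficients; con c
  -- denotes c + 1 and mul α β p denotes ((α + 1) t + β) p, so that the leading
  -- coefficient never vanishes.
  data Poly : ℕ → Set where
    con : ℕ → Poly 0
    mul : ∀ {k} → ℕ → ℕ → Poly k → Poly (suc k)
    add : ∀ {k} → Poly k → Poly k → Poly k

  ⟦_⟧ : ∀ {k} → Poly k → ℕ → ℕ
  ⟦ con c ⟧     t = suc c
  ⟦ mul α β p ⟧ t = (suc α * t + β) * ⟦ p ⟧ t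
  ⟦ add p q ⟧   t = ⟦ p ⟧ t + ⟦ q ⟧ t

  -- `mul` stores the leading coefficient minus one, and `H + α * suc H` is (α + 1)(H + 1) - 1. The
  -- constants in `scale` and `Δ` arise in the same way.
  affine : ∀ {k} → ℕ → ℕ → Poly k → Poly k
  affine H h (con c)     = con c
  affine H h (mul α β p) = mul (H + α * suc H) (suc α * h + β) (affine H h p)
  affine H h (add p q)   = add (affine H h p) (affine H h q)

  ⟦affine⟧ : ∀ {k} H h (p : Poly k) t → ⟦ affine H h p ⟧ t ≡ ⟦ p ⟧ (h + t * suc H)
  ⟦affine⟧ H h (con c)     t = refl
  ⟦affine⟧ H h (mul α β p) t = cong₂ _*_ (eq (suc α) (suc H) h β t) (⟦affine⟧ H h p t)
    where
    eq : ∀ a H h β t → a * H * t + (a * h + β) ≡ a * (h + t * H) + β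
    eq = solve-∀
  ⟦affine⟧ H h (add p q)   t = cong₂ _+_ (⟦affine⟧ H h p t) (⟦affine⟧ H h q t)

  scale : ∀ {k} → ℕ → Poly k → Poly k
  scale c (con d)     = con (d + c * suc d)
  scale c (mul α β p) = mul α β (scale c p)
  scale c (add p q)   = add (scale c p) (scale c q)

  ⟦scale⟧ : ∀ {k} c (p : Poly k) t → ⟦ scale c p ⟧ t ≡ suc c * ⟦ p ⟧ t
  ⟦scale⟧ c (con d)     t = refl
  ⟦scale⟧ c (mul α β p) t = trans (cong ((suc α * t + β) *_) (⟦scale⟧ c p t)) (eq (suc α * t + β) (suc c) (⟦ p ⟧ t))
    where
    eq : ∀ a b x → a * (b * x) ≡ b * (a * x)
    eq = solve-∀
  ⟦scale⟧ c (add p q)   t = trans (cong₂ _+_ (⟦scale⟧ c p t) (⟦scale⟧ c q t))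
                                  (sym (*-distribˡ-+ (suc c) (⟦ p ⟧ t) (⟦ q ⟧ t)))

  constant : (p : Poly 0) → Σ ℕ λ c → ∀ t → ⟦ p ⟧ t ≡ suc c
  constant (con c)   = c , λ _ → refl
  constant (add p q) with constant p | constant q
  ... | c , e | d , e′ = c + suc d , λ t → cong₂ _+_ (e t) (e′ t)

  -- Product rule with s = c + 1: ℓ(t + s)p(t + s) - ℓ(t)p(t) = ℓ(t)(p(t + s) - p(t)) + (ℓ(t + s) -
  -- ℓ(t))p(t + s). In degree one the first summand is zero, which has no code in `Poly`, hence the
  -- separate clause. As the degree drops by exactly one, iterated differences end in a linear
  -- polynomial of nonzero slope.
  Δ : ∀ {k} → ℕ → Poly (suc k) → Poly k
  Δ         c (add p q)   = add (Δ c p) (Δ c q)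
  Δ {zero}  c (mul α β p) = scale (c + α * suc c) p
  Δ {suc k} c (mul α β p) = add (mul α β (Δ c p)) (scale (c + α * suc c) (affine 0 (suc c) p))

  ⟦Δ⟧ : ∀ {k} c (p : Poly (suc k)) t → ⟦ p ⟧ (t + suc c) ≡ ⟦ p ⟧ t + ⟦ Δ c p ⟧ t
  ⟦Δ⟧ c (add p q) t =
    trans (cong₂ _+_ (⟦Δ⟧ c p t) (⟦Δ⟧ c q t)) (eq (⟦ p ⟧ t) (⟦ Δ c p ⟧ t) (⟦ q ⟧ t) (⟦ Δ c q ⟧ t))
    where
    eq : ∀ a b c d → (a + b) + (c + d) ≡ (a + c) + (b + d)
    eq = solve-∀
  ⟦Δ⟧ {zero} c (mul α β p) t with constant p
  ... | d , e = begin
    (suc α * (t + suc c) + β) * ⟦ p ⟧ (t + suc c)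
      ≡⟨ cong ((suc α * (t + suc c) + β) *_) (trans (e _) (sym (e t))) ⟩
    (suc α * (t + suc c) + β) * ⟦ p ⟧ t
      ≡⟨ eq (suc α) t (suc c) β (⟦ p ⟧ t) ⟩
    (suc α * t + β) * ⟦ p ⟧ t + suc α * suc c * ⟦ p ⟧ t
      ≡⟨ cong ((suc α * t + β) * ⟦ p ⟧ t +_) (sym (⟦scale⟧ (c + α * suc c) p t)) ⟩
    (suc α * t + β) * ⟦ p ⟧ t + ⟦ scale (c + α * suc c) p ⟧ t ∎
    where
    open ≡-Reasoning
    eq : ∀ a t c β x → (a * (t + c) + β) * x ≡ (a * t + β) * x + a * c * x
    eq = solve-∀
  ⟦Δ⟧ {suc k} c (mul α β p) t = begin
    (suc α * (t + suc c) + β) * ⟦ p ⟧ (t + suc c)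
      ≡⟨ eq (suc α) t (suc c) β (⟦ p ⟧ (t + suc c)) ⟩
    (suc α * t + β) * ⟦ p ⟧ (t + suc c) + suc α * suc c * ⟦ p ⟧ (t + suc c)
      ≡⟨ cong₂ (λ x y → (suc α * t + β) * x + suc α * suc c * ⟦ p ⟧ y) (⟦Δ⟧ c p t)
           (trans (+-comm t (suc c)) (cong (suc c +_) (sym (*-identityʳ t)))) ⟩
    (suc α * t + β) * (⟦ p ⟧ t + ⟦ Δ c p ⟧ t) + suc α * suc c * ⟦ p ⟧ (suc c + t * 1)
      ≡⟨ cong ((suc α * t + β) * (⟦ p ⟧ t + ⟦ Δ c p ⟧ t) +_)
           (trans (cong (suc α * suc c *_) (sym (⟦affine⟧ 0 (suc c) p t)))
                  (sym (⟦scale⟧ (c + α * suc c) (affine 0 (suc c) p) t))) ⟩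
    (suc α * t + β) * (⟦ p ⟧ t + ⟦ Δ c p ⟧ t) + ⟦ scale (c + α * suc c) (affine 0 (suc c) p) ⟧ t
      ≡⟨ eq′ (suc α * t + β) (⟦ p ⟧ t) (⟦ Δ c p ⟧ t) _ ⟩
    (suc α * t + β) * ⟦ p ⟧ t + ((suc α * t + β) * ⟦ Δ c p ⟧ t + ⟦ scale (c + α * suc c) (affine 0 (suc c) p) ⟧ t) ∎
    where
    open ≡-Reasoning
    eq : ∀ a t c β x → (a * (t + c) + β) * x ≡ (a * t + β) * x + a * c * x
    eq = solve-∀
    eq′ : ∀ a x y z → a * (x + y) + z ≡ a * x + (a * y + z)
    eq′ = solve-∀

  linear : (p : Poly 1) → Σ ℕ λ c → Σ ℕ λ s → ∀ t → ⟦ p ⟧ t ≡ c + suc s * t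
  linear (mul α β p) with constant p
  ... | d , e = β * suc d , d + α * suc d , λ t → trans (cong ((suc α * t + β) *_) (e t)) (eq (suc α) t β (suc d))
    where
    eq : ∀ a t β d → (a * t + β) * d ≡ β * d + a * d * t
    eq = solve-∀
  linear (add p q) with linear p | linear q
  ... | c , s , e | c′ , s′ , e′ = c + c′ , s + suc s′ , λ t → trans (cong₂ _+_ (e t) (e′ t)) (eq c c′ (suc s) (suc s′) t)
    where
    eq : ∀ c c′ s s′ t → (c + s * t) + (c′ + s′ * t) ≡ c + c′ + (s + s′) * t
    eq = solve-∀

  -- The code of (t + 1)^k: the index t = 0 stands for the smallest admissible root 1.
  power : ∀ k → Poly k
  power zero    = con 0
  power (suc k) = mul 0 1 (power k)

  ⟦power⟧ : ∀ k t → ⟦ power k ⟧ t ≡ suc t ^ k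
  ⟦power⟧ zero    t = refl
  ⟦power⟧ (suc k) t = cong₂ _*_ (trans (cong (_+ 1) (*-identityˡ t)) (+-comm t 1)) (⟦power⟧ k t)

  ^-distribʳ-* : ∀ m n k → (m * n) ^ k ≡ m ^ k * n ^ k
  ^-distribʳ-* m n zero    = refl
  ^-distribʳ-* m n (suc k) = trans (cong (m * n *_) (^-distribʳ-* m n k)) (eq m n (m ^ k) (n ^ k))
    where
    eq : ∀ m n x y → m * n * (x * y) ≡ m * x * (n * y)
    eq = solve-∀

-- Van der Corput differencing along polynomials.

module WeylDifferencing where

  open IntegerSums
  open Polynomials

  open import Data.Nat using (ℕ; zero; suc; z≤n; s≤s)
  import Data.Nat as ℕ
  import Data.Nat.Properties as ℕₚ
  import Data.Nat.Tactic.RingSolver as ℕ-Solver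
  open import Data.Integer using (ℤ; +_; 0ℤ; 1ℤ; _+_; _*_; _≤_; _<_; +≤+; +<+)
  open import Data.Integer.Properties
  open import Data.Integer.Tactic.RingSolver using (solve-∀)
  open import Data.Product using (Σ; _×_; _,_)
  open import Data.Empty using (⊥-elim)
  open import Relation.Nullary using (yes; no)
  open import Relation.Binary.PropositionalEquality
  open import Relation.Binary.Definitions using (tri<; tri≈; tri>)

  sq : ℤ → ℤ
  sq a = a * a

  translate-periodic : ∀ {M g} → Periodic M g → ∀ c → Periodic M (λ x → g (x ℕ.+ c))
  translate-periodic {M} {g} per c x = trans (cong g (eq x M c)) (per (x ℕ.+ c))
    where
    eq : ∀ x M c → x ℕ.+ M ℕ.+ c ≡ x ℕ.+ c ℕ.+ M
    eq = ℕ-Solver.solve-∀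

  ∑-periodic : ∀ {M} n {g : ℕ → ℕ → ℤ} → (∀ i → Periodic M (g i)) → Periodic M (λ x → ∑ n (λ i → g i x))
  ∑-periodic n per x = ∑-cong n (λ i → per i x)

  -- Cauchy-Schwarz over the index `i`, followed by an exchange of sums.
  ∑∑-sq-≤ : ∀ n M (E : ℤ) (Y : ℤ) (w : ℕ → ℕ → ℤ) → 0ℤ ≤ E →
    (∀ i → E * ∑ M (λ x → sq (w i x)) ≤ Y) →
    E * ∑ M (λ x → sq (∑ n (λ i → w i x))) ≤ sq (+ n) * Y
  ∑∑-sq-≤ n M E Y w 0≤E bound = begin
    E * ∑ M (λ x → sq (∑ n (λ i → w i x)))
      ≤⟨ *-monoˡ 0≤E (∑-mono M (λ x → sq-∑-≤ n (λ i → w i x))) ⟩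
    E * ∑ M (λ x → + n * ∑ n (λ i → sq (w i x)))
      ≡⟨ cong (E *_) (trans (∑-*ˡ M (+ n) _) (cong (+ n *_) (∑-swap M n (λ x i → sq (w i x))))) ⟩
    E * (+ n * ∑ n (λ i → ∑ M (λ x → sq (w i x))))
      ≡⟨ eq E (+ n) (∑ n (λ i → ∑ M (λ x → sq (w i x)))) ⟩
    + n * (E * ∑ n (λ i → ∑ M (λ x → sq (w i x))))
      ≡⟨ cong (+ n *_) (sym (∑-*ˡ n E _)) ⟩
    + n * ∑ n (λ i → E * ∑ M (λ x → sq (w i x)))
      ≤⟨ *-monoˡ (pos-nonneg {n}) (∑-mono n bound) ⟩
    + n * ∑ n (λ _ → Y)
      ≡⟨ cong (+ n *_) (∑-const n Y) ⟩
    + n * (+ n * Y)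
      ≡⟨ sym (*-assoc (+ n) (+ n) Y) ⟩
    sq (+ n) * Y ∎
    where
    open ≤-Reasoning
    eq : ∀ E n Z → E * (n * Z) ≡ n * (E * Z)
    eq = solve-∀

  δ : ℕ → ℕ → ℤ
  δ i j with i ℕ.≟ j
  ... | yes _ = 1ℤ
  ... | no  _ = 0ℤ

  ∑-δ-beyond : ∀ n i → n ℕ.≤ i → ∑ n (δ i) ≡ 0ℤ
  ∑-δ-beyond zero    i _   = refl
  ∑-δ-beyond (suc n) i n<i with i ℕ.≟ n
  ... | yes refl = ⊥-elim (ℕₚ.<-irrefl refl n<i)
  ... | no _     = trans (+-identityʳ _) (∑-δ-beyond n i (ℕₚ.<⇒≤ n<i))

  ∑-δ-≤1 : ∀ n i → ∑ n (δ i) ≤ 1ℤ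
  ∑-δ-≤1 zero    i = +≤+ z≤n
  ∑-δ-≤1 (suc n) i with i ℕ.≟ n
  ... | yes refl = ≤-reflexive (cong (_+ 1ℤ) (∑-δ-beyond n i ℕₚ.≤-refl))
  ... | no _     = subst (_≤ 1ℤ) (sym (+-identityʳ _)) (∑-δ-≤1 n i)

  -- Each property survives passing to multiples, so the product of the witnesses serves finitely
  -- many indices. This merges the averaging lengths of the polynomials produced by one
  -- differencing.
  common-multiple : (P : ℕ → ℕ → Set) → (∀ i b c → 1 ℕ.≤ c → P i b → P i (c ℕ.* b)) →
    (∀ i → Σ ℕ λ b → (1 ℕ.≤ b) × P i b) → ∀ n → Σ ℕ λ b → (1 ℕ.≤ b) × (∀ i → i ℕ.< n → P i b)
  common-multiple P closed ex zero    = 1 , ℕₚ.≤-refl , λ _ ()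
  common-multiple P closed ex (suc n) with common-multiple P closed ex n | ex n
  ... | b , 1≤b , all | c , 1≤c , Pc = c ℕ.* b , ℕₚ.*-mono-≤ 1≤c 1≤b , go
    where
    go : ∀ i → i ℕ.< suc n → P i (c ℕ.* b)
    go i i<1+n with i ℕ.≟ n
    ... | yes refl = subst (P i) (ℕₚ.*-comm b c) (closed i c b 1≤b Pc)
    ... | no i≢n   = closed i b c 1≤c (all i (ℕₚ.≤∧≢⇒< (ℕₚ.≤-pred i<1+n) i≢n))

  -- Precision required on progressions for precision `E` along a polynomial of degree k + 1. A
  -- differencing with H = 2E + 1 needs correlations to precision H, and Cauchy-Schwarz squares this
  -- to H² for mean squares.
  tolerance : ℕ → ℕ → ℕ
  tolerance zero    E = E
  tolerance (suc k) E = tolerance k (suc (E ℕ.+ E) ℕ.* suc (E ℕ.+ E))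

  module VanDerCorput (k N : ℕ) (1≤N : 1 ℕ.≤ N) where

    -- The steps are perfect powers because an index difference e^(k+1) on such a progression is the
    -- difference (s e)^(k+1) of integers: a set free of power differences stays so when restricted
    -- to it.
    SmallOnProgressions : ℕ → (ℕ → ℤ) → ℤ → ℕ → ℕ → Set
    SmallOnProgressions M g K E b = ∀ s → 1 ℕ.≤ s → s ℕ.≤ b →
      + E * ∑ M (λ x → sq (∑ N (λ t → g (x ℕ.+ s ℕ.^ suc k ℕ.* t)))) ≤ sq (+ N) * K

    -- `b` precedes `M`, `g` and `K`, so it is uniform in the set under study. Allowing every length
    -- `m * b` makes the property pass to multiples of `b`.
    Controlled : (ℕ → ℕ) → ℕ → ℕ → ℕ → Set
    Controlled p E E₀ b = ∀ m M g K → Periodic M g → ∑ M (λ x → sq (g x)) ≤ K →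
      SmallOnProgressions M g K E₀ b →
      + E * ∑ M (λ x → sq (∑ (m ℕ.* b) (λ d → g (x ℕ.+ p d)))) ≤ sq (+ (m ℕ.* b)) * K

    Controlled-* : ∀ {p E E₀} b c → 1 ℕ.≤ c → Controlled p E E₀ b → Controlled p E E₀ (c ℕ.* b)
    Controlled-* {p} {E} b c 1≤c ctrl m M g K per bound small =
      subst (λ T → + E * ∑ M (λ x → sq (∑ T (λ d → g (x ℕ.+ p d)))) ≤ sq (+ T) * K) (ℕₚ.*-assoc m c b)
        (ctrl (m ℕ.* c) M g K per bound
          (λ s 1≤s s≤b → small s 1≤s (ℕₚ.≤-trans s≤b (ℕₚ.m≤n*m b c {{ℕ.>-nonZero 1≤c}}))))

    -- A progression of step s and length (m s) N s^k splits into progressions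
    -- of step s^(k+1) and length N.
    controlled-linear : ∀ {p E} c s → (∀ t → p t ≡ c ℕ.+ suc s ℕ.* t) →
      Controlled p E E (suc s ℕ.* N ℕ.* suc s ℕ.^ k)
    controlled-linear {p} {E} c s lin m M g K per bound small =
      subst (λ T → + E * ∑ M (λ x → sq (∑ T (λ d → g (x ℕ.+ p d)))) ≤ sq (+ T) * K) (sym split)
        (subst₂ _≤_ (cong (+ E *_) (∑-cong M (λ x → cong sq (sym (decompose x))))) total
          (∑∑-sq-≤ (m ℕ.* S) M (+ E) _ _ (pos-nonneg {E}) (λ i →
            ∑∑-sq-≤ P M (+ E) _ _ (pos-nonneg {E}) (λ j →
              subst (λ z → + E * z ≤ sq (+ N) * K) (sym (piece i j)) (small S (s≤s z≤n) S≤b)))))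
      where
      S = suc s
      P = S ℕ.^ k
      b = S ℕ.* N ℕ.* P
      S≤b : S ℕ.≤ b
      S≤b = ℕₚ.≤-trans (ℕₚ.m≤m*n S N {{ℕ.>-nonZero 1≤N}}) (ℕₚ.m≤m*n (S ℕ.* N) P {{ℕₚ.m^n≢0 S k}})
      split : m ℕ.* b ≡ m ℕ.* S ℕ.* N ℕ.* P
      split = eq m S N P
        where
        eq : ∀ m S N P → m ℕ.* (S ℕ.* N ℕ.* P) ≡ m ℕ.* S ℕ.* N ℕ.* P
        eq = ℕ-Solver.solve-∀
      offset : ℕ → ℕ → ℕ
      offset i j = c ℕ.+ S ℕ.* (j ℕ.+ i ℕ.* N ℕ.* P)
      v : ℕ → ℕ → ℕ → ℤ
      v i j x = ∑ N (λ t → g (x ℕ.+ offset i j ℕ.+ S ℕ.^ suc k ℕ.* t))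
      rearrange : ∀ x c S j t i N P →
        x ℕ.+ (c ℕ.+ S ℕ.* (j ℕ.+ (t ℕ.+ i ℕ.* N) ℕ.* P)) ≡ x ℕ.+ (c ℕ.+ S ℕ.* (j ℕ.+ i ℕ.* N ℕ.* P)) ℕ.+ S ℕ.* P ℕ.* t
      rearrange = ℕ-Solver.solve-∀
      decompose : ∀ x → ∑ (m ℕ.* S ℕ.* N ℕ.* P) (λ d → g (x ℕ.+ p d)) ≡ ∑ (m ℕ.* S) (λ i → ∑ P (λ j → v i j x))
      decompose x = trans (∑-block (m ℕ.* S ℕ.* N) P _) (trans (∑-block (m ℕ.* S) N _)
        (∑-cong (m ℕ.* S) (λ i → trans (∑-swap N P _) (∑-cong P (λ j → ∑-cong N (λ t →
          cong g (trans (cong (x ℕ.+_) (lin _)) (rearrange x c S j t i N P))))))))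
      piece : ∀ i j → ∑ M (λ x → sq (v i j x)) ≡ ∑ M (λ x → sq (∑ N (λ t → g (x ℕ.+ S ℕ.^ suc k ℕ.* t))))
      piece i j = ∑-shift {F = λ x → sq (∑ N (λ t → g (x ℕ.+ S ℕ.^ suc k ℕ.* t)))}
        (λ x → cong sq (∑-periodic N (λ t → translate-periodic per (S ℕ.^ suc k ℕ.* t)) x)) (offset i j)
      total : sq (+ (m ℕ.* S)) * (sq (+ P) * (sq (+ N) * K)) ≡ sq (+ (m ℕ.* S ℕ.* N ℕ.* P)) * K
      total = trans (eq (+ (m ℕ.* S)) (+ P) (+ N) K)
        (cong (λ z → sq z * K) (trans (cong (_* + P) (sym (pos-* (m ℕ.* S) N))) (sym (pos-* (m ℕ.* S ℕ.* N) P))))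
        where
        eq : ∀ a b c K → (a * a) * ((b * b) * ((c * c) * K)) ≡ ((a * c * b) * (a * c * b)) * K
        eq = solve-∀

    -- Cauchy-Schwarz against `g` itself, whose square sum is at most `K`; the root taken at the end
    -- turns precision H² into H.
    correlation-bound : ∀ {M g K} T (p : ℕ → ℕ) (H : ℕ) → ∑ M (λ x → sq (g x)) ≤ K →
      + (H ℕ.* H) * ∑ M (λ x → sq (∑ T (λ t → g (x ℕ.+ p t)))) ≤ sq (+ T) * K →
      + H * ∑ M (λ x → g x * ∑ T (λ t → g (x ℕ.+ p t))) ≤ + T * K
    correlation-bound {M} {g} {K} T p H bound small = sq-cancel-≤ (*-nonneg {+ T} pos-nonneg 0≤K) (begin
      (+ H * X) * (+ H * X)         ≡⟨ eq (+ H) X ⟩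
      (+ H * + H) * (X * X)         ≡⟨ cong (_* (X * X)) (sym (pos-* H H)) ⟩
      + (H ℕ.* H) * (X * X)         ≤⟨ *-monoˡ (pos-nonneg {H ℕ.* H}) (Cauchy-Schwarz M g G) ⟩
      + (H ℕ.* H) * (A * B)         ≡⟨ eq′ (+ (H ℕ.* H)) A B ⟩
      A * (+ (H ℕ.* H) * B)         ≤⟨ *-monoˡ (∑-nonneg M (λ x → sq-nonneg (g x))) small ⟩
      A * (sq (+ T) * K)            ≡⟨ *-comm A (sq (+ T) * K) ⟩
      (sq (+ T) * K) * A            ≤⟨ *-monoˡ (*-nonneg (sq-nonneg (+ T)) 0≤K) bound ⟩
      (sq (+ T) * K) * K            ≡⟨ eq″ (+ T) K ⟩
      (+ T * K) * (+ T * K)         ∎)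
      where
      open ≤-Reasoning
      G : ℕ → ℤ
      G x = ∑ T (λ t → g (x ℕ.+ p t))
      X = ∑ M (λ x → g x * G x)
      A = ∑ M (λ x → sq (g x))
      B = ∑ M (λ x → sq (G x))
      0≤K : 0ℤ ≤ K
      0≤K = ≤-trans (∑-nonneg M (λ x → sq-nonneg (g x))) bound
      eq : ∀ h x → (h * x) * (h * x) ≡ (h * h) * (x * x)
      eq = solve-∀
      eq′ : ∀ h a b → h * (a * b) ≡ a * (h * b)
      eq′ = solve-∀
      eq″ : ∀ t k → ((t * t) * k) * k ≡ (t * k) * (t * k)
      eq″ = solve-∀

    -- The T H terms are cut into T blocks of length H, and Cauchy-Schwarz is applied over the
    -- blocks, which leaves no boundary terms. Among the products within blocks, the H diagonal
    -- pairs contribute at most T K each and the fewer than H² others at most T K/H each, in all 2 H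
    -- T K. With the factor T from Cauchy-Schwarz this gains H/2 over (T H)² K, so H = 2E + 1
    -- suffices.
    van-der-Corput : ∀ {M g K} T (p : ℕ → ℕ) (E : ℕ) → let H = suc (E ℕ.+ E) in
      (q : ℕ → ℕ → ℕ → ℕ) →
      (∀ h e t → p (h ℕ.+ t ℕ.* H ℕ.+ suc e) ≡ p (h ℕ.+ t ℕ.* H) ℕ.+ q h e t) →
      Periodic M g → ∑ M (λ x → sq (g x)) ≤ K →
      (∀ h e → h ℕ.< H → e ℕ.< H → + (H ℕ.* H) * ∑ M (λ x → sq (∑ T (λ t → g (x ℕ.+ q h e t)))) ≤ sq (+ T) * K) →
      + E * ∑ M (λ x → sq (∑ (T ℕ.* H) (λ d → g (x ℕ.+ p d)))) ≤ sq (+ (T ℕ.* H)) * K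
    van-der-Corput {M} {g} {K} T p E q diff per bound small = begin
      + E * ∑ M (λ x → sq (∑ (T ℕ.* H) (λ d → g (x ℕ.+ p d))))
        ≤⟨ *-monoˡ (pos-nonneg {E}) (∑-mono M blocks) ⟩
      + E * ∑ M (λ x → + T * ∑ T (λ t → ∑ H (λ h → ∑ H (λ h′ → a t h x * a t h′ x))))
        ≡⟨ cong (+ E *_) (trans (∑-*ˡ M (+ T) _) (cong (+ T *_) reorder)) ⟩
      + E * (+ T * ∑ H (λ h → ∑ H (λ h′ → corr h h′)))
        ≤⟨ *-monoˡ (pos-nonneg {E}) (*-monoˡ (pos-nonneg {T}) corr-total) ⟩
      + E * (+ T * ((+ 2) * + H * (+ T * K)))
        ≤⟨ ≤-by _ (*-nonneg (*-nonneg (pos-nonneg {T}) (*-nonneg (pos-nonneg {T}) 0≤K)) (pos-nonneg {H})) last-step ⟩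
      sq (+ (T ℕ.* H)) * K ∎
      where
      open ≤-Reasoning
      H = suc (E ℕ.+ E)
      a : ℕ → ℕ → ℕ → ℤ
      a t h x = g (x ℕ.+ p (h ℕ.+ t ℕ.* H))
      corr : ℕ → ℕ → ℤ
      corr h h′ = ∑ T (λ t → ∑ M (λ x → a t h x * a t h′ x))
      0≤K : 0ℤ ≤ K
      0≤K = ≤-trans (∑-nonneg M (λ x → sq-nonneg (g x))) bound
      blocks : ∀ x → sq (∑ (T ℕ.* H) (λ d → g (x ℕ.+ p d)))
                 ≤ + T * ∑ T (λ t → ∑ H (λ h → ∑ H (λ h′ → a t h x * a t h′ x)))
      blocks x = subst₂ _≤_ (cong sq (sym (∑-block T H _))) (cong (+ T *_) (∑-cong T (λ t → ∑-sq H (λ h → a t h x))))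
                   (sq-∑-≤ T (λ t → ∑ H (λ h → a t h x)))
      reorder : ∑ M (λ x → ∑ T (λ t → ∑ H (λ h → ∑ H (λ h′ → a t h x * a t h′ x)))) ≡ ∑ H (λ h → ∑ H (λ h′ → corr h h′))
      reorder =
        trans (∑-swap M T _)
        (trans (∑-cong T (λ t → trans (∑-swap M H _) (∑-cong H (λ h → ∑-swap M H _))))
        (trans (∑-swap T H _) (∑-cong H (λ h → ∑-swap T H _))))
      corr-sym : ∀ h h′ → corr h h′ ≡ corr h′ h
      corr-sym h h′ = ∑-cong T (λ t → ∑-cong M (λ x → *-comm (a t h x) (a t h′ x)))
      corr-diag : ∀ h → corr h h ≤ + T * K
      corr-diag h = subst (corr h h ≤_) (∑-const T K) (∑-mono T (λ t →
        subst (_≤ K) (sym (∑-shift {F = λ x → sq (g x)} (λ x → cong sq (per x)) (p (h ℕ.+ t ℕ.* H)))) bound))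
      -- Translating x by p(h + tH) is harmless in ℤ/M and leaves g(x) times g along the difference
      -- polynomial; the sum over t then moves inside.
      corr-shift : ∀ h e → corr h (suc h ℕ.+ e) ≡ ∑ M (λ x → g x * ∑ T (λ t → g (x ℕ.+ q h e t)))
      corr-shift h e = trans (∑-cong T (λ t → trans (∑-cong M (λ x → cong (a t h x *_) (cong g (at-shift x t))))
          (∑-shift {F = λ x → g x * g (x ℕ.+ q h e t)}
            (λ x → cong₂ _*_ (per x) (translate-periodic per (q h e t) x)) (p (h ℕ.+ t ℕ.* H)))))
        (trans (∑-swap T M _) (∑-cong M (λ x → ∑-*ˡ T (g x) _)))
        where
        idx : ∀ h e y → suc h ℕ.+ e ℕ.+ y ≡ h ℕ.+ y ℕ.+ suc e
        idx = ℕ-Solver.solve-∀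
        at-shift : ∀ x t → x ℕ.+ p (suc h ℕ.+ e ℕ.+ t ℕ.* H) ≡ x ℕ.+ p (h ℕ.+ t ℕ.* H) ℕ.+ q h e t
        at-shift x t = trans (cong (x ℕ.+_) (trans (cong p (idx h e (t ℕ.* H))) (diff h e t)))
                             (sym (ℕₚ.+-assoc x (p (h ℕ.+ t ℕ.* H)) (q h e t)))
      corr-< : ∀ h h′ → h ℕ.< h′ → h′ ℕ.< H → + H * corr h h′ ≤ + T * K
      corr-< h h′ h<h′ h′<H with ℕₚ.m≤n⇒∃[o]m+o≡n h<h′
      ... | e , refl = subst (λ z → + H * z ≤ + T * K) (sym (corr-shift h e))
            (correlation-bound {M} {g} T (q h e) H bound
              (small h e (ℕₚ.<-trans h<h′ h′<H) (ℕₚ.≤-<-trans (ℕₚ.m≤n+m e (suc h)) h′<H)))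
      -- One formula for both kinds of pairs: after scaling by H, an off-diagonal pair is charged T
      -- K and the diagonal one an extra H T K, so a row costs at most 2 H T K.
      corr-≤ : ∀ h h′ → h ℕ.< H → h′ ℕ.< H → + H * corr h h′ ≤ (+ T * K) * (1ℤ + + H * δ h h′)
      corr-≤ h h′ h<H h′<H with h ℕ.≟ h′
      ... | yes refl = ≤-trans (*-monoˡ (pos-nonneg {H}) (corr-diag h))
            (≤-by (+ T * K) (*-nonneg {+ T} pos-nonneg 0≤K) (eq (+ H) (+ T * K)))
        where
        eq : ∀ h y → y * (1ℤ + h * 1ℤ) ≡ h * y + y
        eq = solve-∀
      ... | no h≢h′ = subst (+ H * corr h h′ ≤_) (eq (+ H) (+ T * K)) off-diag
        where
        eq : ∀ h y → y ≡ y * (1ℤ + h * 0ℤ)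
        eq = solve-∀
        off-diag : + H * corr h h′ ≤ + T * K
        off-diag with ℕₚ.<-cmp h h′
        ... | tri< h<h′ _ _ = corr-< h h′ h<h′ h′<H
        ... | tri≈ _ h≡h′ _ = ⊥-elim (h≢h′ h≡h′)
        ... | tri> _ _ h′<h = subst (λ z → + H * z ≤ + T * K) (corr-sym h′ h) (corr-< h′ h h′<h h<H)
      corr-row : ∀ h → h ℕ.< H → + H * ∑ H (corr h) ≤ (+ T * K) * ((+ 2) * + H)
      corr-row h h<H = begin
        + H * ∑ H (corr h)                                  ≡⟨ sym (∑-*ˡ H (+ H) _) ⟩
        ∑ H (λ h′ → + H * corr h h′)                        ≤⟨ ∑-mono< H (λ h′ → corr-≤ h h′ h<H) ⟩
        ∑ H (λ h′ → (+ T * K) * (1ℤ + + H * δ h h′))        ≡⟨ ∑-*ˡ H (+ T * K) _ ⟩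
        (+ T * K) * ∑ H (λ h′ → 1ℤ + + H * δ h h′)          ≡⟨ cong ((+ T * K) *_) (trans (∑-+ H (λ _ → 1ℤ) (λ h′ → + H * δ h h′))
                                                                 (cong₂ _+_ (∑-const H 1ℤ) (∑-*ˡ H (+ H) (δ h)))) ⟩
        (+ T * K) * (+ H * 1ℤ + + H * ∑ H (δ h))            ≤⟨ *-monoˡ (*-nonneg {+ T} pos-nonneg 0≤K) (+-monoʳ-≤ (+ H * 1ℤ) (*-monoˡ (pos-nonneg {H}) (∑-δ-≤1 H h))) ⟩
        (+ T * K) * (+ H * 1ℤ + + H * 1ℤ)                   ≡⟨ eq (+ T * K) (+ H) ⟩
        (+ T * K) * ((+ 2) * + H)                           ∎
        where
        eq : ∀ y h → y * (h * 1ℤ + h * 1ℤ) ≡ y * ((+ 2) * h)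
        eq = solve-∀
      corr-total : ∑ H (λ h → ∑ H (λ h′ → corr h h′)) ≤ (+ 2) * + H * (+ T * K)
      corr-total = *-cancelˡ (+ H) (+<+ (s≤s z≤n)) (begin
        + H * ∑ H (λ h → ∑ H (corr h))         ≡⟨ sym (∑-*ˡ H (+ H) _) ⟩
        ∑ H (λ h → + H * ∑ H (corr h))         ≤⟨ ∑-mono< H corr-row ⟩
        ∑ H (λ _ → (+ T * K) * ((+ 2) * + H))  ≡⟨ ∑-const H _ ⟩
        + H * ((+ T * K) * ((+ 2) * + H))      ≡⟨ cong (+ H *_) (*-comm (+ T * K) ((+ 2) * + H)) ⟩
        + H * ((+ 2) * + H * (+ T * K))        ∎)
      H-eq : + H ≡ 1ℤ + (+ E + + E)
      H-eq = trans (pos-+ 1 (E ℕ.+ E)) (cong (λ z → 1ℤ + z) (pos-+ E E))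
      last-step : sq (+ (T ℕ.* H)) * K ≡ + E * (+ T * ((+ 2) * + H * (+ T * K))) + + T * (+ T * K) * + H
      last-step = trans (cong (λ z → sq z * K) (pos-* T H))
        (subst (λ h → sq (+ T * h) * K ≡ + E * (+ T * ((+ 2) * h * (+ T * K))) + + T * (+ T * K) * h) (sym H-eq)
          (eq (+ T) (+ E) K))
        where
        eq : ∀ t e k → (t * (1ℤ + (e + e))) * (t * (1ℤ + (e + e))) * k
           ≡ e * (t * ((+ 2) * (1ℤ + (e + e)) * (t * k))) + t * (t * k) * (1ℤ + (e + e))
        eq = solve-∀

    -- Induction on the degree. Differencing replaces p by the polynomials p(h + tH + e + 1) - p(h +
    -- tH) in t, with h, e < H. There are only H² of them, so one `b` serves all.
    controlled : ∀ {n} (p : Poly (suc n)) E → Σ ℕ λ b → (1 ℕ.≤ b) × Controlled ⟦ p ⟧ E (tolerance n E) b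
    controlled {zero} p E with linear p
    ... | c , s , lin = suc s ℕ.* N ℕ.* suc s ℕ.^ k
        , ℕₚ.*-mono-≤ {1} {_} {1} (ℕₚ.*-mono-≤ {1} {suc s} (s≤s z≤n) 1≤N) (ℕₚ.m^n>0 (suc s) k)
        , controlled-linear {⟦ p ⟧} {E} c s lin
    controlled {suc n} p E = combine ih
      where
      H = suc (E ℕ.+ E)
      E₀ = tolerance (suc n) E
      p′ : ℕ → ℕ → Poly (suc n)
      p′ h e = affine (E ℕ.+ E) h (Δ e p)
      Q : ℕ → ℕ → ℕ → Set
      Q h e b = Controlled ⟦ p′ h e ⟧ (H ℕ.* H) E₀ b
      ih : Σ ℕ λ b → (1 ℕ.≤ b) × (∀ h → h ℕ.< H → ∀ e → e ℕ.< H → Q h e b)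
      ih = common-multiple (λ h b → ∀ e → e ℕ.< H → Q h e b)
             (λ h b c 1≤c all e e<H → Controlled-* {⟦ p′ h e ⟧} {H ℕ.* H} {E₀} b c 1≤c (all e e<H))
             (λ h → common-multiple (Q h) (λ e b c → Controlled-* {⟦ p′ h e ⟧} {H ℕ.* H} {E₀} b c)
               (λ e → controlled (p′ h e) (H ℕ.* H)) H) H
      combine : (Σ ℕ λ b → (1 ℕ.≤ b) × (∀ h → h ℕ.< H → ∀ e → e ℕ.< H → Q h e b)) →
        Σ ℕ λ b → (1 ℕ.≤ b) × Controlled ⟦ p ⟧ E E₀ b
      -- A length m (b H) is read as m b blocks of length H, and m b is an admissible length for the
      -- difference polynomials.
      combine (b , 1≤b , all) = b ℕ.* H , ℕₚ.*-mono-≤ 1≤b (s≤s z≤n) , λ m M g K per bound small →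
        subst (λ T → + E * ∑ M (λ x → sq (∑ T (λ d → g (x ℕ.+ ⟦ p ⟧ d)))) ≤ sq (+ T) * K) (ℕₚ.*-assoc m b H)
          (van-der-Corput (m ℕ.* b) ⟦ p ⟧ E (λ h e → ⟦ p′ h e ⟧)
            (λ h e t → trans (⟦Δ⟧ e p (h ℕ.+ t ℕ.* H)) (cong (⟦ p ⟧ (h ℕ.+ t ℕ.* H) ℕ.+_) (sym (⟦affine⟧ (E ℕ.+ E) h (Δ e p) t))))
            per bound
            (λ h e h<H e<H → all h h<H e e<H m M g K per bound
              (λ s 1≤s s≤b → small s 1≤s (ℕₚ.≤-trans s≤b (ℕₚ.m≤m*n b H)))))

-- The density theorem for power differences.

module DensityTheorem where

  open IntegerSums
  open Polynomials
  open WeylDifferencing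

  open import Data.Bool using (Bool; true; false; _∧_)
  open import Data.Nat using (ℕ; zero; suc; z≤n; s≤s; NonZero)
  import Data.Nat as ℕ
  import Data.Nat.Properties as ℕₚ
  import Data.Nat.DivMod as DM
  import Data.Nat.Tactic.RingSolver as ℕ-Solver
  open import Data.Integer using (ℤ; +_; 0ℤ; 1ℤ; -_; _+_; _*_; _-_; _≤_; _<_; +≤+; +<+; drop‿+≤+; positive)
  open import Data.Integer.Properties
  open import Data.Integer.Tactic.RingSolver using (solve-∀)
  open import Data.Product using (Σ; _×_; _,_; proj₁; proj₂)
  open import Data.Empty using (⊥; ⊥-elim)
  open import Data.Sum using (inj₁; inj₂)
  open import Function using (_∘_)
  open import Relation.Nullary using (yes; no; Dec; ¬_)
  open import Relation.Nullary.Decidable using (⌊_⌋; map′; _×-dec_)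
  open import Relation.Binary.PropositionalEquality
  import Data.Bool.Properties as Boolₚ

  ι : Bool → ℤ
  ι true  = 1ℤ
  ι false = 0ℤ

  ι-nonneg : ∀ b → 0ℤ ≤ ι b
  ι-nonneg true  = +≤+ z≤n
  ι-nonneg false = +≤+ z≤n

  ι-≤1 : ∀ b → ι b ≤ 1ℤ
  ι-≤1 true  = ≤-refl
  ι-≤1 false = +≤+ z≤n

  ∑ι-≤ : ∀ n (f : ℕ → Bool) → ∑ n (ι ∘ f) ≤ + n
  ∑ι-≤ n f = subst (∑ n (ι ∘ f) ≤_) (trans (∑-const n 1ℤ) (*-identityʳ (+ n))) (∑-mono n (λ i → ι-≤1 (f i)))

  n≤n^[1+k] : ∀ n k → 1 ℕ.≤ n → n ℕ.≤ n ℕ.^ suc k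
  n≤n^[1+k] n k 1≤n = ℕₚ.m≤m*n n (n ℕ.^ k) {{ℕₚ.m^n≢0 n k {{ℕ.>-nonZero 1≤n}}}}

  PowerPair : ℕ → ℕ → (ℕ → Bool) → Set
  PowerPair k N f = Σ ℕ λ y → Σ ℕ λ e → (y ℕ.+ suc e ℕ.^ k ℕ.< N) × (f y ≡ true) × (f (y ℕ.+ suc e ℕ.^ k) ≡ true)

  root-< : ∀ k {y e N} → y ℕ.+ suc e ℕ.^ suc k ℕ.< N → e ℕ.< N
  root-< k {y} {e} lt = ℕₚ.≤-trans (n≤n^[1+k] (suc e) k (s≤s z≤n)) (ℕₚ.≤-trans (ℕₚ.m≤n+m _ y) (ℕₚ.<⇒≤ lt))

  -- Point and root both lie below `N`, so a bounded search decides. Through it the contradiction in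
  -- `Descent` becomes an actual pair.
  powerPair? : ∀ k N f → Dec (PowerPair (suc k) N f)
  powerPair? k N f = map′
    (λ { (y , _ , e , _ , p) → y , e , p })
    (λ { (y , e , lt , p) → y , ℕₚ.≤-<-trans (ℕₚ.m≤m+n y _) lt , e , root-< k {y} lt , lt , p })
    (ℕₚ.anyUpTo? (λ y → ℕₚ.anyUpTo? (λ e →
      (y ℕ.+ suc e ℕ.^ suc k ℕ.<? N) ×-dec ((f y Boolₚ.≟ true) ×-dec (f (y ℕ.+ suc e ℕ.^ suc k) Boolₚ.≟ true))) N) N)

  -- The function f on [0, N), extended by zeros to [0, N + W) and then
  -- periodically: differences up to W never wrap around.
  module Extension (f : ℕ → Bool) (N W : ℕ) (1≤N : 1 ℕ.≤ N) where

    M : ℕ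
    M = W ℕ.+ N

    instance
      M≢0 : NonZero M
      M≢0 = ℕ.>-nonZero (ℕₚ.≤-trans 1≤N (ℕₚ.m≤n+m N W))

    ext : ℕ → Bool
    ext x = ⌊ x DM.% M ℕ.<? N ⌋ ∧ f (x DM.% M)

    ext-true : ∀ x → ext x ≡ true → (x DM.% M ℕ.< N) × (f (x DM.% M) ≡ true)
    ext-true x eq with x DM.% M ℕ.<? N
    ... | yes lt = lt , eq

    ext-inside : ∀ x → x ℕ.< N → ext x ≡ f x
    ext-inside x x<N rewrite DM.m<n⇒m%n≡m {M} {x} (ℕₚ.<-≤-trans x<N (ℕₚ.m≤n+m N W)) with x ℕ.<? N
    ... | yes _  = refl
    ... | no x≮N = ⊥-elim (x≮N x<N)

    ext-outside : ∀ x → N ℕ.≤ x → x ℕ.< M → ext x ≡ false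
    ext-outside x N≤x x<M rewrite DM.m<n⇒m%n≡m {M} {x} x<M with x ℕ.<? N
    ... | yes x<N = ⊥-elim (ℕₚ.<⇒≱ x<N N≤x)
    ... | no _    = refl

    ext-periodic : ∀ x → ext (x ℕ.+ M) ≡ ext x
    ext-periodic x = cong (λ z → ⌊ z ℕ.<? N ⌋ ∧ f z) (DM.[m+n]%n≡m%n x M)

    -- The residue of y is below N and v ≤ W, so their sum is below M = W + N and reduction modulo M
    -- leaves it unchanged.
    ext-pair : ∀ y v → v ℕ.≤ W → ext y ≡ true → ext (y ℕ.+ v) ≡ true →
      (y DM.% M ℕ.+ v ℕ.< N) × (f (y DM.% M) ≡ true) × (f (y DM.% M ℕ.+ v) ≡ true)
    ext-pair y v v≤W ey eyv with ext-true y ey | ext-true (y ℕ.+ v) eyv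
    ... | z<N , fz | w<N , fw = subst (ℕ._< N) mod w<N , fz , trans (cong f (sym mod)) fw
      where
      z = y DM.% M
      eq : ∀ z v q → z ℕ.+ q ℕ.+ v ≡ z ℕ.+ v ℕ.+ q
      eq = ℕ-Solver.solve-∀
      mod : (y ℕ.+ v) DM.% M ≡ z ℕ.+ v
      mod = trans (DM.%-congˡ {o = M} (trans (cong (ℕ._+ v) (DM.m≡m%n+[m/n]*n y M)) (eq z v (y DM./ M ℕ.* M))))
            (trans (DM.[m+kn]%n≡m%n (z ℕ.+ v) (y DM./ M) M)
                   (DM.m<n⇒m%n≡m (subst (z ℕ.+ v ℕ.<_) (ℕₚ.+-comm N W) (ℕₚ.+-mono-<-≤ z<N v≤W))))

    ∑-ext : ∑ M (ι ∘ ext) ≡ ∑ N (ι ∘ f)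
    ∑-ext = trans (∑-++ N W (ι ∘ ext)) (trans (cong₂ _+_
      (∑-cong< N (λ i i<N → cong ι (ext-inside i i<N)))
      (trans (∑-cong< W (λ i i<W → cong ι (ext-outside (i ℕ.+ N) (ℕₚ.m≤n+m N i) (ℕₚ.+-monoˡ-< N i<W)))) (∑-zero W)))
      (+-identityʳ (∑ N (ι ∘ f))))

  -- The density threshold is the fraction j/Q; with `Q` held fixed, density steps of size 1/Q
  -- become an induction on `j`.
  Recurrent : ℕ → ℕ → ℕ → ℕ → Set
  Recurrent k Q j N = ∀ f → + j * + N ≤ + Q * ∑ N (ι ∘ f) → PowerPair k N f

  ∑-affine : ∀ n (Q a : ℤ) (u : ℕ → ℤ) → ∑ n (λ i → Q * u i - a) ≡ Q * ∑ n u - + n * a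
  ∑-affine n Q a u = trans (∑-+ n (λ i → Q * u i) (λ _ → - a))
    (cong₂ _+_ (∑-*ˡ n Q u) (trans (∑-const n (- a)) (sym (neg-distribʳ-* (+ n) a))))

  -- Let α = (j + 1)/Q and g = f - α for a set f of density at least j/Q without
  -- power differences.  By hypothesis f has density at most α on every long
  -- progression of step s^k, hence almost exactly α on most of them, so g is
  -- controlled along k-th powers; but the sum of f(x) g(x + d^k) is -α times
  -- that of f(x).
  module Descent (k c Q j N′ E : ℕ) (2c³<E : 2 ℕ.* (c ℕ.* c ℕ.* c) ℕ.< E)
    (tol≤Q : 2 ℕ.* tolerance k E ℕ.≤ Q) (Q≤cj : Q ℕ.≤ c ℕ.* j) (j<Q : j ℕ.< Q)
    (1≤N′ : 1 ℕ.≤ N′) (rec : Recurrent (suc k) Q (suc j) N′) where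

    open VanDerCorput k N′ 1≤N′

    K₁ = suc k
    a = suc j
    E₀ = tolerance k E

    b : ℕ
    b = proj₁ (controlled (power K₁) E)

    1≤b : 1 ℕ.≤ b
    1≤b = proj₁ (proj₂ (controlled (power K₁) E))

    -- `W` bounds every difference that occurs: (s e)^K₁ with s ≤ b and e ≤ N′ from the
    -- progressions, and d^K₁ with d ≤ b. Taking N = Q W makes the zero padding a mere fraction 1/Q
    -- of N.
    W N : ℕ
    W = (b ℕ.* N′) ℕ.^ K₁
    N = Q ℕ.* W

    1≤Q : 1 ℕ.≤ Q
    1≤Q = ℕₚ.≤-trans (s≤s z≤n) j<Q

    1≤W : 1 ℕ.≤ W
    1≤W = ℕₚ.m^n>0 (b ℕ.* N′) {{ℕ.>-nonZero (ℕₚ.*-mono-≤ 1≤b 1≤N′)}} K₁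

    1≤N : 1 ℕ.≤ N
    1≤N = ℕₚ.*-mono-≤ 1≤Q 1≤W

    1≤j : 1 ℕ.≤ j
    1≤j = ℕₚ.n≢0⇒n>0 (λ j≡0 → ℕₚ.<⇒≱ 1≤Q (subst (Q ℕ.≤_) (trans (cong (c ℕ.*_) j≡0) (ℕₚ.*-zeroʳ c)) Q≤cj))

    module _ (f : ℕ → Bool) (dense : + j * + N ≤ + Q * ∑ N (ι ∘ f)) (none : ¬ PowerPair K₁ N f) where

      open Extension f N W 1≤N

      F : ℤ
      F = ∑ M (ι ∘ ext)

      ext-none : ∀ y e → suc e ℕ.≤ b ℕ.* N′ → ext y ≡ true → ext (y ℕ.+ suc e ℕ.^ K₁) ≡ true → ⊥
      ext-none y e le ey ey′ = none (y DM.% M , e , ext-pair y (suc e ℕ.^ K₁) (ℕₚ.^-monoˡ-≤ K₁ le) ey ey′)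

      g : ℕ → ℤ
      g x = + Q * ι (ext x) - + a

      g-periodic : Periodic M g
      g-periodic x = cong (λ z → + Q * ι z - + a) (ext-periodic x)

      0≤Q-a : 0ℤ ≤ + Q - + a
      0≤Q-a = diff-nonneg (+≤+ j<Q)

      K : ℤ
      K = sq (+ Q) * + M

      g-bound : ∑ M (λ x → sq (g x)) ≤ K
      g-bound = subst (∑ M (λ x → sq (g x)) ≤_) (trans (∑-const M (sq (+ Q))) (*-comm (+ M) (sq (+ Q)))) (∑-mono M (λ x → pointwise (ext x)))
        where
        eq₁ : ∀ Q a → Q * Q ≡ (Q * 1ℤ - a) * (Q * 1ℤ - a) + a * (Q + (Q - a))
        eq₁ = solve-∀
        eq₀ : ∀ Q a → Q * Q ≡ (Q * 0ℤ - a) * (Q * 0ℤ - a) + (Q - a) * (Q + a)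
        eq₀ = solve-∀
        pointwise : ∀ z → sq (+ Q * ι z - + a) ≤ sq (+ Q)
        pointwise true  = ≤-by _ (*-nonneg (pos-nonneg {a}) (+-nonneg (pos-nonneg {Q}) 0≤Q-a)) (eq₁ (+ Q) (+ a))
        pointwise false = ≤-by _ (*-nonneg 0≤Q-a (+-nonneg (pos-nonneg {Q}) (pos-nonneg {a}))) (eq₀ (+ Q) (+ a))

      QF-bound : + j * + N ≤ + Q * F
      QF-bound = subst (λ z → + j * + N ≤ + Q * z) (sym ∑-ext) dense

      -- The density in ℤ/M misses (j + 1)/Q by at most 2/Q: one 1/Q because only j/Q is assumed,
      -- the other because the padding dilutes the set.
      deficit : + a * + M - + Q * F ≤ + 2 * + M
      deficit = ≤-by _ (+-nonneg (diff-nonneg QF-bound) (diff-nonneg jW≤M)) identity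
        where
        jW≤M : + j * + W ≤ + M
        jW≤M = subst (_≤ + M) (pos-* j W) (+≤+ (ℕₚ.≤-trans (ℕₚ.*-monoˡ-≤ W (ℕₚ.<⇒≤ j<Q)) (ℕₚ.m≤n+m N W)))
        eq : ∀ j W N QF → + 2 * (W + N) ≡ ((1ℤ + j) * (W + N) - QF) + ((QF - j * N) + ((W + N) - j * W))
        eq = solve-∀
        identity : + 2 * + M ≡ (+ a * + M - + Q * F) + ((+ Q * F - + j * + N) + (+ M - + j * + W))
        identity = subst (λ m → + 2 * m ≡ (+ a * m - + Q * F) + ((+ Q * F - + j * + N) + (m - + j * + W))) (sym (pos-+ W N))
          (eq (+ j) (+ W) (+ N) (+ Q * F))

      -- By `rec` no progression sum `U x` is positive, so U² ≤ Q N′ (-U) pointwise, and the mean of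
      -- -U is at most 2 N′ by `deficit`. The mean square is thus at most 2 Q N′², while Q² N′²/E₀
      -- is allowed; hence the condition 2 E₀ ≤ Q.
      small : SmallOnProgressions M g K E₀ b
      small (suc s) _ s≤b = begin
        + E₀ * ∑ M (λ x → sq (U x))
          ≤⟨ *-monoˡ (pos-nonneg {E₀}) (∑-mono M U-sq) ⟩
        + E₀ * ∑ M (λ x → (+ Q * + N′) * (- U x))
          ≡⟨ cong (+ E₀ *_) (trans (∑-*ˡ M (+ Q * + N′) (λ x → - U x)) (cong ((+ Q * + N′) *_) ∑-U)) ⟩
        + E₀ * ((+ Q * + N′) * (+ N′ * (+ a * + M - + Q * F)))
          ≤⟨ *-monoˡ (pos-nonneg {E₀}) (*-monoˡ (*-nonneg (pos-nonneg {Q}) (pos-nonneg {N′})) (*-monoˡ (pos-nonneg {N′}) deficit)) ⟩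
        + E₀ * ((+ Q * + N′) * (+ N′ * (+ 2 * + M)))
          ≡⟨ eq (+ E₀) (+ Q) (+ N′) (+ M) ⟩
        (+ Q * (+ N′ * + N′) * + M) * (+ 2 * + E₀)
          ≤⟨ *-monoˡ (*-nonneg (*-nonneg (pos-nonneg {Q}) (sq-nonneg (+ N′))) (pos-nonneg {M})) (subst (_≤ + Q) (pos-* 2 E₀) (+≤+ tol≤Q)) ⟩
        (+ Q * (+ N′ * + N′) * + M) * + Q
          ≡⟨ eq′ (+ Q) (+ N′) (+ M) ⟩
        sq (+ N′) * K ∎
        where
        open ≤-Reasoning
        eq : ∀ E Q N M → E * ((Q * N) * (N * (+ 2 * M))) ≡ (Q * (N * N) * M) * (+ 2 * E)
        eq = solve-∀
        eq′ : ∀ Q N M → (Q * (N * N) * M) * Q ≡ (N * N) * ((Q * Q) * M)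
        eq′ = solve-∀
        S = suc s
        sub : ℕ → ℕ → Bool
        sub x t = ext (x ℕ.+ S ℕ.^ K₁ ℕ.* t)
        U : ℕ → ℤ
        U x = ∑ N′ (λ t → g (x ℕ.+ S ℕ.^ K₁ ℕ.* t))
        cnt : ℕ → ℤ
        cnt x = ∑ N′ (ι ∘ sub x)
        U-eq : ∀ x → U x ≡ + Q * cnt x - + N′ * + a
        U-eq x = ∑-affine N′ (+ Q) (+ a) (ι ∘ sub x)
        sub-none : ∀ x → ¬ PowerPair K₁ N′ (sub x)
        -- `e + s * suc e` is S (e + 1) - 1: the index difference (e + 1)^K₁ becomes (S (e + 1))^K₁
        -- in ℤ/M, with root at most b N′.
        sub-none x (y , e , lt , fy , fy′) = ext-none (x ℕ.+ S ℕ.^ K₁ ℕ.* y) (e ℕ.+ s ℕ.* suc e)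
          (ℕₚ.*-mono-≤ s≤b (root-< k {y} lt)) fy
          (trans (cong ext (trans (cong (x ℕ.+ S ℕ.^ K₁ ℕ.* y ℕ.+_) (^-distribʳ-* S (suc e) K₁)) (idx x (S ℕ.^ K₁) y (suc e ℕ.^ K₁)))) fy′)
          where
          idx : ∀ x p y q → x ℕ.+ p ℕ.* y ℕ.+ p ℕ.* q ≡ x ℕ.+ p ℕ.* (y ℕ.+ q)
          idx = ℕ-Solver.solve-∀
        cnt-≤ : ∀ x → + Q * cnt x ≤ + a * + N′
        cnt-≤ x with ≤-total (+ Q * cnt x) (+ a * + N′)
        ... | inj₁ le = le
        ... | inj₂ ge = ⊥-elim (sub-none x (rec (sub x) ge))
        U-sq : ∀ x → sq (U x) ≤ (+ Q * + N′) * (- U x)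
        U-sq x = subst (λ u → sq u ≤ (+ Q * + N′) * (- u)) (sym (U-eq x))
          (≤-by _ (*-nonneg (diff-nonneg (cnt-≤ x))
                    (+-nonneg (*-nonneg 0≤Q-a (pos-nonneg {N′})) (*-nonneg (pos-nonneg {Q}) (∑-nonneg N′ (λ t → ι-nonneg (sub x t))))))
                  (identity (+ Q) (+ N′) (+ a) (cnt x)))
          where
          identity : ∀ Q N a c → (Q * N) * (- (Q * c - N * a))
            ≡ (Q * c - N * a) * (Q * c - N * a) + (a * N - Q * c) * ((Q - a) * N + Q * c)
          identity = solve-∀
        ∑-U : ∑ M (λ x → - U x) ≡ + N′ * (+ a * + M - + Q * F)
        ∑-U = begin-equality
          ∑ M (λ x → - U x)                 ≡⟨ ∑-cong M (λ x → sym (-1*i≡-i (U x))) ⟩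
          ∑ M (λ x → - 1ℤ * U x)            ≡⟨ ∑-*ˡ M (- 1ℤ) U ⟩
          - 1ℤ * ∑ M U                      ≡⟨ cong (- 1ℤ *_) (∑-swap M N′ (λ x t → g (x ℕ.+ S ℕ.^ K₁ ℕ.* t))) ⟩
          - 1ℤ * ∑ N′ (λ t → ∑ M (λ x → g (x ℕ.+ S ℕ.^ K₁ ℕ.* t)))
                                            ≡⟨ cong (- 1ℤ *_) (trans (∑-cong N′ (λ t → ∑-shift g-periodic (S ℕ.^ K₁ ℕ.* t))) (∑-const N′ (∑ M g))) ⟩
          - 1ℤ * (+ N′ * ∑ M g)             ≡⟨ cong (λ z → - 1ℤ * (+ N′ * z)) (∑-affine M (+ Q) (+ a) (ι ∘ ext)) ⟩
          - 1ℤ * (+ N′ * (+ Q * F - + M * + a)) ≡⟨ eq″ (+ N′) (+ Q * F) (+ M) (+ a) ⟩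
          + N′ * (+ a * + M - + Q * F) ∎
          where
          eq″ : ∀ n qf m a → - 1ℤ * (n * (qf - m * a)) ≡ n * (a * m - qf)
          eq″ = solve-∀

      G : ℕ → ℤ
      G x = ∑ b (λ d → g (x ℕ.+ suc d ℕ.^ K₁))

      G-small : + E * ∑ M (λ x → sq (G x)) ≤ sq (+ b) * K
      G-small = subst₂ _≤_
        (cong (+ E *_) (∑-cong M (λ x → cong sq (trans (cong (λ T → ∑ T (λ d → g (x ℕ.+ ⟦ power K₁ ⟧ d))) (ℕₚ.*-identityˡ b))
          (∑-cong b (λ d → cong (λ z → g (x ℕ.+ z)) (⟦power⟧ K₁ d)))))))
        (cong (λ T → sq (+ T) * K) (ℕₚ.*-identityˡ b))
        (proj₂ (proj₂ (controlled (power K₁) E)) 1 M g K g-periodic g-bound small)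

      -- If x lies in the set then no x + d^K₁ with d ≤ b does, so `g` takes its lowest value -a at
      -- each of them.
      on-support : ∀ x → ι (ext x) * G x ≡ ι (ext x) * (- (+ a * + b))
      on-support x with ext x in ex
      ... | false = refl
      ... | true  = cong (1ℤ *_) (trans (∑-cong< b (λ d d<b → value d d<b)) (trans (∑-const b (- + a)) (eq (+ b) (+ a))))
        where
        eq : ∀ b a → b * (- a) ≡ - (a * b)
        eq = solve-∀
        zero-case : ∀ Q a → Q * 0ℤ - a ≡ - a
        zero-case = solve-∀
        value : ∀ d → d ℕ.< b → g (x ℕ.+ suc d ℕ.^ K₁) ≡ - + a
        value d d<b with ext (x ℕ.+ suc d ℕ.^ K₁) in ed
        ... | true  = ⊥-elim (ext-none x d (ℕₚ.≤-trans d<b (ℕₚ.m≤m*n b N′ {{ℕ.>-nonZero 1≤N′}})) ex ed)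
        ... | false = zero-case (+ Q) (+ a)

      correlation : ∑ M (λ x → ι (ext x) * G x) ≡ F * (- (+ a * + b))
      correlation = trans (∑-cong M on-support) (∑-*ʳ M (- (+ a * + b)) (ι ∘ ext))

      ι-sq : ∑ M (λ x → ι (ext x) * ι (ext x)) ≡ F
      ι-sq = ∑-cong M (λ x → idem (ext x))
        where
        idem : ∀ z → ι z * ι z ≡ ι z
        idem true  = refl
        idem false = refl

      0<QF : 0ℤ < + Q * F
      0<QF = <-≤-trans (subst (0ℤ <_) (pos-* j N) (+<+ (ℕₚ.*-mono-≤ 1≤j 1≤N))) QF-bound

      0<F : 0ℤ < F
      0<F with ≤-total F 0ℤ
      ... | inj₁ F≤0 = ⊥-elim (<⇒≱ 0<QF (subst (+ Q * F ≤_) (*-zeroʳ (+ Q)) (*-monoˡ (pos-nonneg {Q}) F≤0)))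
      ... | inj₂ 0≤F = ≤∧≢⇒< 0≤F (λ 0≡F → <-irrefl refl (subst (0ℤ <_) (trans (cong (+ Q *_) (sym 0≡F)) (*-zeroʳ (+ Q))) 0<QF))

      *-pos : ∀ {x y} → 0ℤ < x → 0ℤ < y → 0ℤ < x * y
      *-pos {x} {y} 0<x 0<y = subst (_< x * y) (*-zeroʳ x) (*-monoˡ-<-pos x {{positive 0<x}} 0<y)

      -- Cauchy-Schwarz for the indicator of the set against `G`: their correlation is -a b F,
      -- `G-small` bounds `G`, and the positive factor F b² cancels.
      key : + E * (+ a * + a) * F ≤ (+ Q * + Q) * + M
      key = *-cancelˡ (F * (+ b * + b)) (*-pos 0<F (*-pos (+<+ 1≤b) (+<+ 1≤b))) (begin
        F * (+ b * + b) * (+ E * (+ a * + a) * F)              ≡⟨ eq F (+ b) (+ E) (+ a) ⟩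
        + E * ((F * (- (+ a * + b))) * (F * (- (+ a * + b))))  ≤⟨ *-monoˡ (pos-nonneg {E}) cs ⟩
        + E * (F * ∑ M (λ x → sq (G x)))                       ≡⟨ eq′ (+ E) F (∑ M (λ x → sq (G x))) ⟩
        F * (+ E * ∑ M (λ x → sq (G x)))                       ≤⟨ *-monoˡ (<⇒≤ 0<F) G-small ⟩
        F * ((+ b * + b) * ((+ Q * + Q) * + M))                ≡⟨ sym (*-assoc F (+ b * + b) ((+ Q * + Q) * + M)) ⟩
        F * (+ b * + b) * ((+ Q * + Q) * + M)                  ∎)
        where
        open ≤-Reasoning
        eq : ∀ F b E a → F * (b * b) * (E * (a * a) * F) ≡ E * ((F * (- (a * b))) * (F * (- (a * b))))
        eq = solve-∀
        eq′ : ∀ E F S → E * (F * S) ≡ F * (E * S)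
        eq′ = solve-∀
        cs : (F * (- (+ a * + b))) * (F * (- (+ a * + b))) ≤ F * ∑ M (λ x → sq (G x))
        cs = subst₂ _≤_ (cong₂ _*_ correlation correlation) (cong (_* ∑ M (λ x → sq (G x))) ι-sq) (Cauchy-Schwarz M (ι ∘ ext) G)

      -- Since a ≥ Q/c and F ≥ M/(2c), the left side of `key` is at least E Q² M/(2c³). This is the
      -- origin of the condition 2c³ < E.
      impossible : ⊥
      impossible = ℕₚ.<⇒≱ 2c³<E (drop‿+≤+ (subst (+ E ≤_) c³-eq (*-cancelˡ (+ Q * + Q * + Q * + M) 0<Q³M (begin
        + Q * + Q * + Q * + M * + E
          ≡⟨ eq₁ (+ Q) (+ M) (+ E) ⟩
        (+ Q * + E * + M) * (+ Q * + Q)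
          ≤⟨ *-monoˡ (*-nonneg (*-nonneg (pos-nonneg {Q}) (pos-nonneg {E})) (pos-nonneg {M})) (≤-trans (*-monoˡ (pos-nonneg {Q}) Q≤ca)
               (subst (_≤ + c * + a * (+ c * + a)) (*-comm (+ c * + a) (+ Q)) (*-monoˡ (*-nonneg (pos-nonneg {c}) (pos-nonneg {a})) Q≤ca))) ⟩
        (+ Q * + E * + M) * (+ c * + a * (+ c * + a))
          ≡⟨ eq₂ (+ Q) (+ E) (+ M) (+ c) (+ a) ⟩
        (+ c * + c * (+ E * (+ a * + a))) * (+ M * + Q)
          ≤⟨ *-monoˡ (*-nonneg (*-nonneg (pos-nonneg {c}) (pos-nonneg {c})) (*-nonneg (pos-nonneg {E}) (sq-nonneg (+ a)))) MQ≤ ⟩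
        (+ c * + c * (+ E * (+ a * + a))) * (+ 2 * + c * + Q * F)
          ≡⟨ eq₃ (+ c) (+ E * (+ a * + a)) (+ Q) F ⟩
        (+ 2 * (+ c * + c * + c) * + Q) * (+ E * (+ a * + a) * F)
          ≤⟨ *-monoˡ (*-nonneg (*-nonneg {+ 2} pos-nonneg (*-nonneg (*-nonneg (pos-nonneg {c}) (pos-nonneg {c})) (pos-nonneg {c}))) (pos-nonneg {Q})) key ⟩
        (+ 2 * (+ c * + c * + c) * + Q) * ((+ Q * + Q) * + M)
          ≡⟨ eq₄ (+ c) (+ Q) (+ M) ⟩
        + Q * + Q * + Q * + M * (+ 2 * (+ c * + c * + c)) ∎))))
        where
        open ≤-Reasoning
        c³-eq : + 2 * (+ c * + c * + c) ≡ + (2 ℕ.* (c ℕ.* c ℕ.* c))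
        c³-eq = sym (trans (pos-* 2 (c ℕ.* c ℕ.* c)) (cong (+ 2 *_) (trans (pos-* (c ℕ.* c) c) (cong (_* + c) (pos-* c c)))))
        0<Q : 0ℤ < + Q
        0<Q = +<+ 1≤Q
        0<Q³M : 0ℤ < + Q * + Q * + Q * + M
        0<Q³M = *-pos (*-pos (*-pos 0<Q 0<Q) 0<Q) (+<+ (ℕₚ.≤-trans 1≤N (ℕₚ.m≤n+m N W)))
        eq₁ : ∀ Q M E → Q * Q * Q * M * E ≡ (Q * E * M) * (Q * Q)
        eq₁ = solve-∀
        eq₂ : ∀ Q E M c a → (Q * E * M) * (c * a * (c * a)) ≡ (c * c * (E * (a * a))) * (M * Q)
        eq₂ = solve-∀
        eq₃ : ∀ c X Q F → (c * c * X) * (+ 2 * c * Q * F) ≡ (+ 2 * (c * c * c) * Q) * (X * F)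
        eq₃ = solve-∀
        eq₄ : ∀ c Q M → (+ 2 * (c * c * c) * Q) * ((Q * Q) * M) ≡ Q * Q * Q * M * (+ 2 * (c * c * c))
        eq₄ = solve-∀
        Q≤cj′ : + Q ≤ + c * + j
        Q≤cj′ = subst (+ Q ≤_) (pos-* c j) (+≤+ Q≤cj)
        Q≤ca : + Q ≤ + c * + a
        Q≤ca = ≤-trans Q≤cj′ (*-monoˡ (pos-nonneg {c}) (+≤+ (ℕₚ.n≤1+n j)))
        M≤2N : + M ≤ + 2 * + N
        M≤2N = subst (+ M ≤_) (pos-* 2 N) (+≤+ (ℕₚ.≤-trans (ℕₚ.+-monoˡ-≤ N (ℕₚ.m≤n*m W Q {{ℕ.>-nonZero 1≤Q}})) (ℕₚ.≤-reflexive (cong (N ℕ.+_) (sym (ℕₚ.+-identityʳ N))))))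
        MQ≤ : + M * + Q ≤ + 2 * + c * + Q * F
        MQ≤ = begin
          + M * + Q                     ≤⟨ *-monoˡ (pos-nonneg {M}) Q≤cj′ ⟩
          + M * (+ c * + j)             ≡⟨ *-comm (+ M) (+ c * + j) ⟩
          + c * + j * + M               ≤⟨ *-monoˡ (*-nonneg (pos-nonneg {c}) (pos-nonneg {j})) M≤2N ⟩
          + c * + j * (+ 2 * + N)       ≡⟨ eq₅ (+ c) (+ j) (+ N) ⟩
          (+ 2 * + c) * (+ j * + N)     ≤⟨ *-monoˡ (*-nonneg {+ 2} pos-nonneg (pos-nonneg {c})) QF-bound ⟩
          (+ 2 * + c) * (+ Q * F)       ≡⟨ sym (*-assoc (+ 2 * + c) (+ Q) F) ⟩
          + 2 * + c * + Q * F           ∎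
          where
          eq₅ : ∀ c j N → c * j * (+ 2 * N) ≡ (+ 2 * c) * (j * N)
          eq₅ = solve-∀

    descend : Σ ℕ λ N → (1 ℕ.≤ N) × Recurrent K₁ Q j N
    descend = N , 1≤N , found
      where
      found : Recurrent K₁ Q j N
      found f dense with powerPair? k N f
      ... | yes pair = pair
      ... | no none  = ⊥-elim (impossible f dense none)

  -- Density one on [0, 2) means that 0 and 1 both belong, and they differ by 1^(k+1).
  recurrent-full : ∀ k Q → 1 ℕ.≤ Q → Recurrent (suc k) Q Q 2
  recurrent-full k Q 1≤Q f dense = 0 , 0 , ℕₚ.≤-reflexive (cong suc (ℕₚ.^-zeroˡ (suc k))) , both
    where
    ∑≥2 : + 2 ≤ ∑ 2 (ι ∘ f)
    ∑≥2 = *-cancelˡ (+ Q) (+<+ 1≤Q) dense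
    both : (f 0 ≡ true) × (f (1 ℕ.^ suc k) ≡ true)
    both rewrite ℕₚ.^-zeroˡ (suc k) with f 0 | f 1 | ∑≥2
    ... | true  | true  | _ = refl , refl
    ... | true  | false | +≤+ (s≤s ())
    ... | false | true  | +≤+ (s≤s ())
    ... | false | false | +≤+ ()

  -- The target density 1/c is written as j₀/Q with Q = c j₀, where j₀ exceeds twice the tolerance
  -- for precision E = 2c³ + 1. Every rung j₀ ≤ j < Q then meets the hypotheses of `Descent`.
  Sárközy : ∀ k c → 1 ℕ.≤ c → Σ ℕ λ N → (1 ℕ.≤ N) × Recurrent (suc k) c 1 N
  Sárközy k c 1≤c = rescale (ladder (Q ℕ.∸ j₀) j₀ (ℕₚ.m∸n+n≡m j₀≤Q) ℕₚ.≤-refl)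
    where
    E = suc (2 ℕ.* (c ℕ.* c ℕ.* c))
    j₀ = suc (2 ℕ.* tolerance k E)
    Q = c ℕ.* j₀
    j₀≤Q : j₀ ℕ.≤ Q
    j₀≤Q = ℕₚ.m≤n*m j₀ c {{ℕ.>-nonZero 1≤c}}
    -- Induction on Q - j, from density Q/Q = 1 downwards.
    ladder : ∀ i j → i ℕ.+ j ≡ Q → j₀ ℕ.≤ j → Σ ℕ λ N → (1 ℕ.≤ N) × Recurrent (suc k) Q j N
    ladder zero    j eq _ rewrite eq = 2 , s≤s z≤n , recurrent-full k Q (ℕₚ.≤-trans (s≤s z≤n) j₀≤Q)
    ladder (suc i) j eq j₀≤j with ladder i (suc j) (trans (ℕₚ.+-suc i j) eq) (ℕₚ.m≤n⇒m≤1+n j₀≤j)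
    ... | N′ , 1≤N′ , rec = Descent.descend k c Q j N′ E ℕₚ.≤-refl
          (ℕₚ.≤-trans (ℕₚ.n≤1+n _) j₀≤Q) (ℕₚ.*-monoʳ-≤ c j₀≤j) (ℕₚ.≤-trans (s≤s (ℕₚ.m≤n+m j i)) (ℕₚ.≤-reflexive eq)) 1≤N′ rec
    rescale : (Σ ℕ λ N → (1 ℕ.≤ N) × Recurrent (suc k) Q j₀ N) → Σ ℕ λ N → (1 ℕ.≤ N) × Recurrent (suc k) c 1 N
    rescale (N , 1≤N , rec) = N , 1≤N , λ f dense → rec f (subst₂ _≤_ (cong (+ j₀ *_) (*-identityˡ (+ N)))
      (trans (sym (*-assoc (+ j₀) (+ c) (∑ N (ι ∘ f)))) (cong (_* ∑ N (ι ∘ f)) (trans (*-comm (+ j₀) (+ c)) (sym (pos-* c j₀)))))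
      (*-monoˡ (pos-nonneg {j₀}) dense))

-- Supersaturation by averaging over scales.

module Varnavides where

  open IntegerSums
  open Polynomials
  open WeylDifferencing
  open DensityTheorem

  open import Data.Bool using (Bool; true; false)
  open import Data.Nat using (ℕ; zero; suc; z≤n; s≤s)
  import Data.Nat as ℕ
  import Data.Nat.Properties as ℕₚ
  import Data.Nat.DivMod as DM
  import Data.Nat.Tactic.RingSolver as ℕ-Solver
  open import Data.Integer using (ℤ; +_; 0ℤ; 1ℤ; -_; _+_; _*_; _-_; _≤_; _<_; +<+)
  open import Data.Integer.Properties
  open import Data.Integer.Tactic.RingSolver using (solve-∀)
  open import Data.Product using (Σ; _×_; _,_; proj₁; proj₂)
  open import Data.Empty using (⊥-elim)
  open import Data.Sum using (inj₁; inj₂)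
  open import Function using (_∘_)
  open import Relation.Nullary using (yes; no; Dec)
  open import Relation.Binary.PropositionalEquality

  ∑-pigeonhole : ∀ n {B f} → + suc n * B ≤ ∑ (suc n) f → Σ ℕ λ i → (i ℕ.≤ n) × (B ≤ f i)
  ∑-pigeonhole zero    {B} {f} le = 0 , z≤n , subst₂ _≤_ (*-identityˡ B) (+-identityˡ (f 0)) le
  ∑-pigeonhole (suc n) {B} {f} le = cases (B ≤? f (suc n))
    where
    eq : ∀ a b S y → S ≡ a * b + (((S + y) - (1ℤ + a) * b) + (b - y))
    eq = solve-∀
    weaken : (Σ ℕ λ i → (i ℕ.≤ n) × (B ≤ f i)) → Σ ℕ λ i → (i ℕ.≤ suc n) × (B ≤ f i)
    weaken (i , i≤n , p) = i , ℕₚ.m≤n⇒m≤1+n i≤n , p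
    cases : Dec (B ≤ f (suc n)) → Σ ℕ λ i → (i ℕ.≤ suc n) × (B ≤ f i)
    cases (yes p) = suc n , ℕₚ.≤-refl , p
    cases (no p)  = weaken (∑-pigeonhole n {B} {f} (≤-by _ (+-nonneg (diff-nonneg le) (diff-nonneg (<⇒≤ (≰⇒> p))))
      (eq (+ suc n) B (∑ (suc n) f) (f (suc n)))))

  average-≤ : ∀ n {B f} → 1 ℕ.≤ n → + n * B ≤ ∑ n f → Σ ℕ λ i → (i ℕ.< n) × (B ≤ f i)
  average-≤ (suc n) _ le = let i , i≤n , p = ∑-pigeonhole n le in i , s≤s i≤n , p

  module Supersaturation (k c N₀ : ℕ) (1≤c : 1 ℕ.≤ c) (1≤N₀ : 1 ℕ.≤ N₀) (rec : Recurrent (suc k) c 1 N₀)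
    (n β : ℕ) (1≤n : 1 ℕ.≤ n) (1≤β : 1 ℕ.≤ β) where

    private
      K₁ = suc k

    -- Each scale D yields at least M/(c N₀) pairs, spread over N₀ values of e. With c N₀² β scales
    -- some e receives at least β M of them, that is β per point on average. `gap` bounds all
    -- differences used.
    scales gap : ℕ
    scales = c ℕ.* (N₀ ℕ.* N₀) ℕ.* β
    gap = (scales ℕ.* N₀) ℕ.^ K₁

    module _ (f : ℕ → Bool) (dense : + 2 * + (gap ℕ.+ n) ≤ + c * ∑ n (ι ∘ f)) where

      open Extension f n gap 1≤n

      F : ℤ
      F = ∑ M (ι ∘ ext)

      step : ℕ → ℕ → ℕ
      step D e = (suc D ℕ.* suc e) ℕ.^ K₁

      χ : ℕ → ℕ → ℤ
      χ v x = ι (ext x) * ι (ext (x ℕ.+ v))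

      χ-nonneg : ∀ v x → 0ℤ ≤ χ v x
      χ-nonneg v x = *-nonneg (ι-nonneg (ext x)) (ι-nonneg (ext (x ℕ.+ v)))

      χ-periodic : ∀ v → Periodic M (χ v)
      χ-periodic v x = cong₂ _*_ (cong ι (ext-periodic x)) (translate-periodic {M} {ι ∘ ext} (λ y → cong ι (ext-periodic y)) v x)

      X : ℕ → ℕ → ℤ
      X D e = ∑ M (χ (step D e))

      module _ (D : ℕ) where
        S : ℕ
        S = suc D ℕ.^ K₁

        sub : ℕ → ℕ → Bool
        sub x t = ext (x ℕ.+ S ℕ.* t)

        cnt pairs : ℕ → ℤ
        cnt x = ∑ N₀ (ι ∘ sub x)
        pairs x = ∑ N₀ (λ t → ∑ N₀ (λ e → χ (step D e) (x ℕ.+ S ℕ.* t)))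

        row-nonneg : ∀ x t → 0ℤ ≤ ∑ N₀ (λ e → χ (step D e) (x ℕ.+ S ℕ.* t))
        row-nonneg x t = ∑-nonneg N₀ (λ e → χ-nonneg (step D e) (x ℕ.+ S ℕ.* t))

        pairs-≥1 : ∀ x → PowerPair K₁ N₀ (sub x) → 1ℤ ≤ pairs x
        pairs-≥1 x (y , e , lt , fy , fy′) = begin
          1ℤ                                            ≡⟨ cong₂ (λ u v → ι u * ι v) (sym fy) (sym fz) ⟩
          χ (step D e) (x ℕ.+ S ℕ.* y)                  ≤⟨ ∑-term N₀ (λ e → χ-nonneg (step D e) (x ℕ.+ S ℕ.* y)) (root-< k {y} lt) ⟩
          ∑ N₀ (λ e → χ (step D e) (x ℕ.+ S ℕ.* y))     ≤⟨ ∑-term N₀ (row-nonneg x) (ℕₚ.≤-<-trans (ℕₚ.m≤m+n y _) lt) ⟩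
          pairs x                                       ∎
          where
          open ≤-Reasoning
          idx : ∀ x p y q → x ℕ.+ p ℕ.* y ℕ.+ p ℕ.* q ≡ x ℕ.+ p ℕ.* (y ℕ.+ q)
          idx = ℕ-Solver.solve-∀
          fz : ext (x ℕ.+ S ℕ.* y ℕ.+ step D e) ≡ true
          fz = trans (cong ext (trans (cong (x ℕ.+ S ℕ.* y ℕ.+_) (^-distribʳ-* (suc D) (suc e) K₁)) (idx x S y (suc e ℕ.^ K₁)))) fy′

        pairs-nonneg : ∀ x → 0ℤ ≤ pairs x
        pairs-nonneg x = ∑-nonneg N₀ (row-nonneg x)

        -- Either the progression at x has density at most 1/c, or it contains a pair by `rec`, and
        -- then the trivial bound cnt ≤ N₀ is enough.
        local : ∀ x → + c * cnt x ≤ + N₀ + (+ c * + N₀) * pairs x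
        local x with ≤-total (+ c * cnt x) (1ℤ * + N₀)
        ... | inj₁ le = ≤-trans le (≤-by _ (*-nonneg (*-nonneg (pos-nonneg {c}) (pos-nonneg {N₀})) (pairs-nonneg x))
                          (cong (_+ (+ c * + N₀) * pairs x) (sym (*-identityˡ (+ N₀)))))
        ... | inj₂ ge = begin
          + c * cnt x                         ≤⟨ *-monoˡ (pos-nonneg {c}) (∑ι-≤ N₀ (sub x)) ⟩
          + c * + N₀                          ≡⟨ sym (*-identityʳ (+ c * + N₀)) ⟩
          (+ c * + N₀) * 1ℤ                   ≤⟨ *-monoˡ (*-nonneg (pos-nonneg {c}) (pos-nonneg {N₀})) (pairs-≥1 x (rec (sub x) ge)) ⟩
          (+ c * + N₀) * pairs x              ≤⟨ ≤-by (+ N₀) (pos-nonneg {N₀}) (+-comm (+ N₀) ((+ c * + N₀) * pairs x)) ⟩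
          + N₀ + (+ c * + N₀) * pairs x       ∎
          where open ≤-Reasoning

        ∑-cnt : ∑ M cnt ≡ + N₀ * F
        ∑-cnt = trans (∑-swap M N₀ (λ x t → ι (sub x t)))
          (trans (∑-cong N₀ (λ t → ∑-shift {F = ι ∘ ext} (λ x → cong ι (ext-periodic x)) (S ℕ.* t))) (∑-const N₀ F))

        ∑-pairs : ∑ M pairs ≡ + N₀ * ∑ N₀ (X D)
        ∑-pairs = trans (∑-swap M N₀ _) (trans (∑-cong N₀ (λ t → trans (∑-swap M N₀ _)
          (∑-cong N₀ (λ e → ∑-shift (χ-periodic (step D e)) (S ℕ.* t))))) (∑-const N₀ (∑ N₀ (X D))))

        -- The density 2/c is twice what `rec` needs: the first term of `local` absorbs at most half
        -- of the total count, and pairs must pay for the rest.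
        many : + M ≤ (+ c * + N₀) * ∑ N₀ (X D)
        many = *-cancelˡ (+ N₀) (+<+ 1≤N₀) (≤-by _ (+-nonneg (diff-nonneg total) (*-nonneg (pos-nonneg {N₀}) (diff-nonneg dense′)))
                 (identity (+ c) (+ N₀) F (+ M) (∑ N₀ (X D))))
          where
          dense′ : + 2 * + M ≤ + c * F
          dense′ = subst (λ z → + 2 * + M ≤ + c * z) (sym ∑-ext) dense
          total : + c * (+ N₀ * F) ≤ + M * + N₀ + (+ c * + N₀) * (+ N₀ * ∑ N₀ (X D))
          total = subst₂ _≤_ (trans (∑-*ˡ M (+ c) cnt) (cong (+ c *_) ∑-cnt))
            (trans (∑-+ M (λ _ → + N₀) (λ x → (+ c * + N₀) * pairs x))
              (cong₂ _+_ (∑-const M (+ N₀)) (trans (∑-*ˡ M (+ c * + N₀) pairs) (cong ((+ c * + N₀) *_) ∑-pairs))))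
            (∑-mono M local)
          identity : ∀ c N F M Y → N * ((c * N) * Y) ≡ N * M + (((M * N + (c * N) * (N * Y)) - c * (N * F)) + N * (c * F - + 2 * M))
          identity = solve-∀

      -- For fixed `e` distinct scales `D` give distinct differences, so this counts different
      -- neighbours of x; a sum over `e` as well would count products (D + 1)(e + 1) with
      -- multiplicity.
      V : ℕ → ℕ → ℤ
      V e x = ∑ scales (λ D → ι (ext (x ℕ.+ step D e)))

      all-scales : + N₀ * (+ M * + β) ≤ ∑ N₀ (λ e → ∑ M (λ x → ι (ext x) * V e x))
      all-scales = *-cancelˡ (+ c * + N₀) (subst (0ℤ <_) (pos-* c N₀) (+<+ (ℕₚ.*-mono-≤ 1≤c 1≤N₀))) (begin
        (+ c * + N₀) * (+ N₀ * (+ M * + β))        ≡⟨ eq (+ c) (+ N₀) (+ M) (+ β) ⟩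
        (+ c * (+ N₀ * + N₀) * + β) * + M          ≡⟨ cong (_* + M) (sym cast) ⟩
        + scales * + M                             ≡⟨ sym (∑-const scales (+ M)) ⟩
        ∑ scales (λ _ → + M)                       ≤⟨ ∑-mono scales many ⟩
        ∑ scales (λ D → (+ c * + N₀) * ∑ N₀ (X D)) ≡⟨ ∑-*ˡ scales (+ c * + N₀) _ ⟩
        (+ c * + N₀) * ∑ scales (λ D → ∑ N₀ (X D)) ≡⟨ cong ((+ c * + N₀) *_) reorder ⟩
        (+ c * + N₀) * ∑ N₀ (λ e → ∑ M (λ x → ι (ext x) * V e x)) ∎)
        where
        open ≤-Reasoning
        eq : ∀ c N M b → (c * N) * (N * (M * b)) ≡ (c * (N * N) * b) * M
        eq = solve-∀
        cast : + scales ≡ + c * (+ N₀ * + N₀) * + β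
        cast = trans (pos-* (c ℕ.* (N₀ ℕ.* N₀)) β) (cong (_* + β) (trans (pos-* c (N₀ ℕ.* N₀)) (cong (+ c *_) (pos-* N₀ N₀))))
        reorder : ∑ scales (λ D → ∑ N₀ (X D)) ≡ ∑ N₀ (λ e → ∑ M (λ x → ι (ext x) * V e x))
        reorder = trans (∑-swap scales N₀ _) (∑-cong N₀ (λ e → trans (∑-swap scales M _)
          (∑-cong M (λ x → ∑-*ˡ scales (ι (ext x)) _))))

      RichVertex : Set
      RichVertex = Σ ℕ λ x → Σ ℕ λ e → (x ℕ.< n) × (f x ≡ true) ×
        (+ β ≤ ∑ scales (λ D → ι (f (x ℕ.+ (suc D ℕ.* suc e) ℕ.^ K₁))))

      rich-vertex : RichVertex
      rich-vertex = choose-x (average-≤ N₀ 1≤N₀ all-scales)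
        where
        finish : ∀ e x → e ℕ.< N₀ → x ℕ.< M → ∀ z → ext x ≡ z → + β ≤ ι z * V e x → RichVertex
        finish e x e<N₀ x<M false ex le = ⊥-elim (<⇒≱ (+<+ 1≤β) le)
        finish e x e<N₀ x<M true  ex le =
          x , e , subst (ℕ._< n) mod (proj₁ (ext-true x ex)) , trans (cong f (sym mod)) (proj₂ (ext-true x ex)) ,
          ≤-trans (subst (+ β ≤_) (*-identityˡ (V e x)) le) (∑-mono< scales (λ D D<s → compare D D<s _ refl))
          where
          mod : x DM.% M ≡ x
          mod = DM.m<n⇒m%n≡m x<M
          compare : ∀ D → D ℕ.< scales → ∀ z → ext (x ℕ.+ step D e) ≡ z → ι z ≤ ι (f (x ℕ.+ step D e))
          compare D D<s false _  = ι-nonneg (f (x ℕ.+ step D e))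
          compare D D<s true  eD = ≤-reflexive (cong ι (sym (trans (cong (λ z → f (z ℕ.+ step D e)) (sym mod))
            (proj₂ (proj₂ (ext-pair x (step D e) (ℕₚ.^-monoˡ-≤ K₁ (ℕₚ.*-mono-≤ D<s e<N₀)) ex eD))))))
        choose-x : (Σ ℕ λ e → (e ℕ.< N₀) × (+ M * + β ≤ ∑ M (λ x → ι (ext x) * V e x))) → RichVertex
        choose-x (e , e<N₀ , le) =
          let x , x<M , le′ = average-≤ M (ℕₚ.≤-trans 1≤n (ℕₚ.m≤n+m n gap)) le
          in finish e x e<N₀ x<M (ext x) refl le′

-- Elementary inequalities for powers.

module Estimates where

  open Polynomials using (^-distribʳ-*)
  open import Data.Nat
  open import Data.Nat.Properties
  open import Data.Nat.Tactic.RingSolver using (solve-∀)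
  open import Data.Product using (Σ; _×_; _,_)
  open import Data.Empty using (⊥-elim)
  open import Relation.Nullary using (¬_; yes; no; Dec)
  open import Relation.Binary.PropositionalEquality

  Bernoulli : ∀ n r b → n ^ b * (n + b * r) ≤ n * (n + r) ^ b
  Bernoulli n r zero    = ≤-reflexive (trans (cong (1 *_) (+-identityʳ n)) (*-comm 1 n))
  Bernoulli n r (suc b) = begin
    n * n ^ b * (n + (r + b * r))            ≤⟨ m≤m+n _ (n ^ b * (b * r * r)) ⟩
    n * n ^ b * (n + (r + b * r)) + n ^ b * (b * r * r)
                                             ≡⟨ eq n r b (n ^ b) ⟩
    n ^ b * (n + b * r) * (n + r)            ≤⟨ *-monoˡ-≤ (n + r) (Bernoulli n r b) ⟩
    n * (n + r) ^ b * (n + r)                ≡⟨ eq′ n (n + r) ((n + r) ^ b) ⟩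
    n * ((n + r) * (n + r) ^ b)              ∎
    where
    open ≤-Reasoning
    eq : ∀ n r b x → n * x * (n + (r + b * r)) + x * (b * r * r) ≡ x * (n + b * r) * (n + r)
    eq = solve-∀
    eq′ : ∀ a b x → a * x * b ≡ a * (b * x)
    eq′ = solve-∀

  [2+y]y≡ : ∀ y → suc ((2 + y) * y) ≡ suc y * suc y
  [2+y]y≡ = solve-∀

  -- (1 + 1/y)^(y+1) decreases from its value 4 at y = 1.
  [1+y]^[1+y]≤4y^[1+y] : ∀ y → suc (suc y) ^ suc (suc y) ≤ 4 * suc y ^ suc (suc y)
  [1+y]^[1+y]≤4y^[1+y] zero    = ≤-refl
  [1+y]^[1+y]≤4y^[1+y] (suc x) = *-cancelʳ-≤ _ _ (y ^ suc y) {{m^n≢0 y (suc y)}} (begin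
    (2 + y) ^ (2 + y) * y ^ suc y                ≡⟨ trans (assoc₁ (2 + y) ((2 + y) ^ suc y) (y ^ suc y)) (cong ((2 + y) *_) (sym (^-distribʳ-* (2 + y) y (suc y)))) ⟩
    (2 + y) * z ^ suc y                          ≤⟨ Bernoulli-step ⟩
    suc y * (1 + z) ^ suc y                      ≡⟨ cong (λ w → suc y * w) (trans (cong (_^ suc y) ([2+y]y≡ y)) (^-distribʳ-* (suc y) (suc y) (suc y))) ⟩
    suc y * (suc y ^ suc y * suc y ^ suc y)      ≡⟨ assoc₂ (suc y) (suc y ^ suc y) ⟩
    suc y ^ (2 + y) * suc y ^ suc y              ≤⟨ *-monoʳ-≤ (suc y ^ (2 + y)) ([1+y]^[1+y]≤4y^[1+y] x) ⟩
    suc y ^ (2 + y) * (4 * y ^ suc y)            ≡⟨ assoc₃ (suc y ^ (2 + y)) (y ^ suc y) ⟩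
    4 * suc y ^ (2 + y) * y ^ suc y              ∎)
    where
    open ≤-Reasoning
    y = suc x
    z = (2 + y) * y
    assoc₁ : ∀ a b c → a * b * c ≡ a * (b * c)
    assoc₁ = solve-∀
    assoc₂ : ∀ a b → a * (b * b) ≡ a * b * b
    assoc₂ = solve-∀
    assoc₃ : ∀ a b → a * (4 * b) ≡ 4 * a * b
    assoc₃ = solve-∀
    Bernoulli-step : (2 + y) * z ^ suc y ≤ suc y * (1 + z) ^ suc y
    Bernoulli-step = *-cancelˡ-≤ z (begin
      z * ((2 + y) * z ^ suc y)                  ≡⟨ eq₁ z y (z ^ suc y) ⟩
      z ^ suc y * (z * suc y + z)                ≤⟨ *-monoʳ-≤ (z ^ suc y) (+-monoʳ-≤ (z * suc y) (≤-trans (n≤1+n z) (≤-reflexive ([2+y]y≡ y)))) ⟩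
      z ^ suc y * (z * suc y + suc y * suc y)    ≡⟨ eq₂ (z ^ suc y) z (suc y) ⟩
      suc y * (z ^ suc y * (z + suc y * 1))      ≤⟨ *-monoʳ-≤ (suc y) (Bernoulli z 1 (suc y)) ⟩
      suc y * (z * (z + 1) ^ suc y)              ≡⟨ cong (λ w → suc y * (z * w ^ suc y)) (+-comm z 1) ⟩
      suc y * (z * (1 + z) ^ suc y)              ≡⟨ eq₃ (suc y) z ((1 + z) ^ suc y) ⟩
      z * (suc y * (1 + z) ^ suc y)              ∎)
      where
      eq₁ : ∀ z y p → z * ((2 + y) * p) ≡ p * (z * suc y + z)
      eq₁ = solve-∀
      eq₂ : ∀ p z w → p * (z * w + w * w) ≡ w * (p * (z + w * 1))
      eq₂ = solve-∀
      eq₃ : ∀ a z b → a * (z * b) ≡ z * (a * b)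
      eq₃ = solve-∀

  [1+y]^y≤4y^y : ∀ y .{{_ : NonZero y}} → suc y ^ y ≤ 4 * y ^ y
  [1+y]^y≤4y^y y@(suc x) = *-cancelˡ-≤ y (begin
    y * suc y ^ y        ≤⟨ *-monoˡ-≤ (suc y ^ y) (n≤1+n y) ⟩
    suc y ^ suc y        ≤⟨ [1+y]^[1+y]≤4y^[1+y] x ⟩
    4 * y ^ suc y        ≡⟨ eq y (y ^ y) ⟩
    y * (4 * y ^ y)      ∎)
    where
    open ≤-Reasoning
    eq : ∀ y p → 4 * (y * p) ≡ y * (4 * p)
    eq = solve-∀

  ^-swap : ∀ a m n → (a ^ m) ^ n ≡ (a ^ n) ^ m
  ^-swap a m n = trans (^-*-assoc a m n) (trans (cong (a ^_) (*-comm m n)) (sym (^-*-assoc a n m)))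

  -- (1 + x/y)^y ≤ (1 + 1/y)^(xy) ≤ 4^x
  [y+x]^y≤4^x*y^y : ∀ y x .{{_ : NonZero y}} → (y + x) ^ y ≤ 4 ^ x * y ^ y
  [y+x]^y≤4^x*y^y y x = *-cancelʳ-≤ _ _ ((y ^ x) ^ y) {{m^n≢0 (y ^ x) y {{m^n≢0 y x}}}} (begin
    (y + x) ^ y * (y ^ x) ^ y            ≡⟨ sym (^-distribʳ-* (y + x) (y ^ x) y) ⟩
    ((y + x) * y ^ x) ^ y                ≤⟨ ^-monoˡ-≤ y base ⟩
    (y * suc y ^ x) ^ y                  ≡⟨ ^-distribʳ-* y (suc y ^ x) y ⟩
    y ^ y * (suc y ^ x) ^ y              ≡⟨ cong (y ^ y *_) (^-swap (suc y) x y) ⟩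
    y ^ y * (suc y ^ y) ^ x              ≤⟨ *-monoʳ-≤ (y ^ y) (^-monoˡ-≤ x ([1+y]^y≤4y^y y)) ⟩
    y ^ y * (4 * y ^ y) ^ x              ≡⟨ cong (y ^ y *_) (trans (^-distribʳ-* 4 (y ^ y) x) (cong (4 ^ x *_) (^-swap y y x))) ⟩
    y ^ y * (4 ^ x * (y ^ x) ^ y)        ≡⟨ eq (y ^ y) (4 ^ x) ((y ^ x) ^ y) ⟩
    4 ^ x * y ^ y * (y ^ x) ^ y          ∎)
    where
    open ≤-Reasoning
    eq : ∀ a b c → a * (b * c) ≡ b * a * c
    eq = solve-∀
    base : (y + x) * y ^ x ≤ y * suc y ^ x
    base = begin
      (y + x) * y ^ x         ≡⟨ trans (*-comm (y + x) (y ^ x)) (cong (λ w → y ^ x * (y + w)) (sym (*-identityʳ x))) ⟩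
      y ^ x * (y + x * 1)     ≤⟨ Bernoulli y 1 x ⟩
      y * (y + 1) ^ x         ≡⟨ cong (λ w → y * w ^ x) (+-comm y 1) ⟩
      y * suc y ^ x           ∎

  ^-cancelˡ-≤ : ∀ k {a b} → a ^ suc k ≤ b ^ suc k → a ≤ b
  ^-cancelˡ-≤ k {a} {b} le = ≮⇒≥ (λ b<a → <⇒≱ (^-monoˡ-< (suc k) b<a) le)

  ^-injectiveˡ : ∀ k {a b} → a ^ suc k ≡ b ^ suc k → a ≡ b
  ^-injectiveˡ k eq = ≤-antisym (^-cancelˡ-≤ k (≤-reflexive eq)) (^-cancelˡ-≤ k (≤-reflexive (sym eq)))

  n<2^n : ∀ n → n < 2 ^ n
  n<2^n zero    = s≤s z≤n
  n<2^n (suc n) = begin-strict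
    suc n            ≤⟨ n<2^n n ⟩
    2 ^ n            <⟨ m<m+n (2 ^ n) (m^n>0 2 n) ⟩
    2 ^ n + 2 ^ n    ≡⟨ cong (2 ^ n +_) (sym (+-identityʳ (2 ^ n))) ⟩
    2 * 2 ^ n        ∎
    where open ≤-Reasoning

  -- Downward search for a place where `P` switches off. It stands in for the root n^(1/k)/G when β
  -- is chosen.
  last-true : (P : ℕ → Set) → (∀ i → Dec (P i)) → P 1 → ∀ n → ¬ P (suc n) → Σ ℕ λ b → (1 ≤ b) × P b × ¬ P (suc b)
  last-true P P? P1 zero    ¬P1 = ⊥-elim (¬P1 P1)
  last-true P P? P1 (suc n) ¬P  with P? (suc n)
  ... | yes p = suc n , s≤s z≤n , p , ¬P
  ... | no ¬p = last-true P P? P1 n ¬p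

-- Subsets as Boolean functions, and the container recursion.

module IndependentSets where

  open IntegerSums using (∑; ∑-head)
  open DensityTheorem using (ι)
  open import Data.Bool using (Bool; true; false)
  open import Data.Nat
  open import Data.Nat.Properties
  open import Data.Nat.Tactic.RingSolver using (solve-∀)
  import Data.Integer as ℤ
  import Data.Integer.Properties as ℤₚ
  import Data.Integer.Tactic.RingSolver as ℤ-Solver
  open import Data.Fin using (Fin; toℕ; zero; suc)
  open import Data.Fin.Subset using (Subset; _∈_; ∣_∣; inside; outside; ⊥)
  open import Data.Fin.Subset.Properties using (p⊆q⇒∣p∣≤∣q∣)
  open import Data.Vec using ([]; _∷_; here; there)
  open import Data.List using (List; []; _∷_; _++_; map; length)
  open import Data.List.Properties using (length-++; length-map)
  open import Data.List.Membership.Propositional renaming (_∈_ to _∈ˡ_)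
  open import Data.List.Membership.Propositional.Properties using (∈-++⁺ˡ; ∈-++⁺ʳ; ∈-map⁺)
  open import Data.List.Relation.Unary.Any using (here)
  open import Data.Product using (Σ; _×_; _,_; proj₂)
  open import Data.Empty using (⊥-elim)
  open import Function using (_∘_)
  open import Relation.Nullary using (yes; no)
  open import Relation.Binary.PropositionalEquality

  -- False beyond `n`, so a subset becomes a total function on ℕ, to which the density theorem
  -- applies and which can be evaluated at x + d^k without a bound.
  mem : ∀ {n} → Subset n → ℕ → Bool
  mem []      x       = false
  mem (b ∷ U) zero    = b
  mem (b ∷ U) (suc x) = mem U x

  ∈⇒mem : ∀ {n} {U : Subset n} {i} → i ∈ U → mem U (toℕ i) ≡ true
  ∈⇒mem here      = refl
  ∈⇒mem (there p) = ∈⇒mem p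

  mem⇒∈ : ∀ {n} (U : Subset n) i → mem U (toℕ i) ≡ true → i ∈ U
  mem⇒∈ (true ∷ U) zero    refl = here
  mem⇒∈ (b ∷ U)    (suc i) eq   = there (mem⇒∈ U i eq)

  mem⇒Fin : ∀ {n} (U : Subset n) x → mem U x ≡ true → Σ (Fin n) λ i → (toℕ i ≡ x) × (i ∈ U)
  mem⇒Fin (true ∷ U) zero    refl = zero , refl , here
  mem⇒Fin (b ∷ U)    (suc x) eq   with mem⇒Fin U x eq
  ... | i , eq′ , i∈U = suc i , cong suc eq′ , there i∈U

  ∑-mem : ∀ {n} (U : Subset n) → ∑ n (ι ∘ mem U) ≡ ℤ.+ ∣ U ∣
  ∑-mem []                  = refl
  ∑-mem {suc n} (true ∷ U)  = trans (∑-head n (ι ∘ mem (true ∷ U))) (cong (ℤ._+_ ℤ.1ℤ) (∑-mem U))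
  ∑-mem {suc n} (false ∷ U) = trans (∑-head n (ι ∘ mem (false ∷ U))) (trans (ℤₚ.+-identityˡ (∑ n (ι ∘ mem U))) (∑-mem U))

  infix 4 _⊑_
  _⊑_ : ∀ {n} → Subset n → Subset n → Set
  J ⊑ U = ∀ y → mem J y ≡ true → mem U y ≡ true

  ⊑⇒∣∣≤ : ∀ {n} (J U : Subset n) → J ⊑ U → ∣ J ∣ ≤ ∣ U ∣
  ⊑⇒∣∣≤ J U J⊑U = p⊆q⇒∣p∣≤∣q∣ {p = J} {q = U} (λ {i} i∈J → mem⇒∈ U i (J⊑U (toℕ i) (∈⇒mem i∈J)))

  remove insert : ∀ {n} → ℕ → Subset n → Subset n
  remove x       []      = []
  remove zero    (b ∷ U) = outside ∷ U
  remove (suc x) (b ∷ U) = b ∷ remove x U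
  insert x       []      = []
  insert zero    (b ∷ U) = inside ∷ U
  insert (suc x) (b ∷ U) = b ∷ insert x U

  insert-remove : ∀ {n} x (U : Subset n) → mem U x ≡ true → insert x (remove x U) ≡ U
  insert-remove zero    (true ∷ U) refl = refl
  insert-remove (suc x) (b ∷ U)    eq   = cong (b ∷_) (insert-remove x U eq)

  ∣remove∣ : ∀ {n} x (U : Subset n) → mem U x ≡ true → suc ∣ remove x U ∣ ≡ ∣ U ∣
  ∣remove∣ zero    (true ∷ U)  refl = refl
  ∣remove∣ (suc x) (true ∷ U)  eq   = cong suc (∣remove∣ x U eq)
  ∣remove∣ (suc x) (false ∷ U) eq   = ∣remove∣ x U eq

  remove-absent : ∀ {n} x (U : Subset n) → mem U x ≡ false → remove x U ≡ U
  remove-absent x       []          eq   = refl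
  remove-absent zero    (false ∷ U) refl = refl
  remove-absent (suc x) (b ∷ U)     eq   = cong (b ∷_) (remove-absent x U eq)

  mem-remove-≢ : ∀ {n} x y (U : Subset n) → y ≢ x → mem (remove x U) y ≡ mem U y
  mem-remove-≢ x       y       []      y≢x = refl
  mem-remove-≢ zero    zero    (b ∷ U) y≢x = ⊥-elim (y≢x refl)
  mem-remove-≢ zero    (suc y) (b ∷ U) y≢x = refl
  mem-remove-≢ (suc x) zero    (b ∷ U) y≢x = refl
  mem-remove-≢ (suc x) (suc y) (b ∷ U) y≢x = mem-remove-≢ x y U (y≢x ∘ cong suc)

  mem-remove-≡ : ∀ {n} x (U : Subset n) → mem (remove x U) x ≡ false
  mem-remove-≡ x       []      = refl
  mem-remove-≡ zero    (b ∷ U) = refl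
  mem-remove-≡ (suc x) (b ∷ U) = mem-remove-≡ x U

  mem-remove⁻ : ∀ {n} x y (U : Subset n) → mem (remove x U) y ≡ true → (y ≢ x) × (mem U y ≡ true)
  mem-remove⁻ x y U eq = y≢x , trans (sym (mem-remove-≢ x y U y≢x)) eq
    where
    y≢x : y ≢ x
    y≢x refl with trans (sym eq) (mem-remove-≡ x U)
    ... | ()

  removeAll : ∀ {n} → (ℕ → ℕ) → ℕ → Subset n → Subset n
  removeAll a zero    U = U
  removeAll a (suc m) U = remove (a m) (removeAll a m U)

  mem-removeAll : ∀ {n} a m y (U : Subset n) → (∀ i → i < m → y ≢ a i) → mem (removeAll a m U) y ≡ mem U y
  mem-removeAll a zero    y U y≢a = refl
  mem-removeAll a (suc m) y U y≢a = trans (mem-remove-≢ (a m) y (removeAll a m U) (y≢a m ≤-refl))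
    (mem-removeAll a m y U (λ i i<m → y≢a i (m<n⇒m<1+n i<m)))

  -- By injectivity `a m` is not among the points removed before, so it still lowers the size by one
  -- if it lies in `U`.
  ∣removeAll∣ : ∀ {n} a → (∀ i j → a i ≡ a j → i ≡ j) → ∀ m (U : Subset n) →
    ℤ.+ ∣ removeAll a m U ∣ ℤ.+ ∑ m (λ i → ι (mem U (a i))) ≡ ℤ.+ ∣ U ∣
  ∣removeAll∣ a inj zero    U = ℤₚ.+-identityʳ _
  ∣removeAll∣ a inj (suc m) U = trans (cases (mem U (a m)) refl) (∣removeAll∣ a inj m U)
    where
    U′ = removeAll a m U
    S = ∑ m (λ i → ι (mem U (a i)))
    same : mem U′ (a m) ≡ mem U (a m)
    same = mem-removeAll a m (a m) U (λ i i<m eq → <-irrefl (inj i m (sym eq)) i<m)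
    eq₁ : ∀ u s → u ℤ.+ (s ℤ.+ ℤ.1ℤ) ≡ (ℤ.1ℤ ℤ.+ u) ℤ.+ s
    eq₁ = ℤ-Solver.solve-∀
    cases : ∀ b → mem U (a m) ≡ b → ℤ.+ ∣ remove (a m) U′ ∣ ℤ.+ (S ℤ.+ ι b) ≡ ℤ.+ ∣ U′ ∣ ℤ.+ S
    cases true  eq = trans (eq₁ (ℤ.+ ∣ remove (a m) U′ ∣) S) (cong (λ z → ℤ.+ z ℤ.+ S) (∣remove∣ (a m) U′ (trans same eq)))
    cases false eq = cong₂ ℤ._+_ (cong (λ V → ℤ.+ ∣ V ∣) (remove-absent (a m) U′ (trans same eq))) (ℤₚ.+-identityʳ S)

  element : ∀ {n} (U : Subset n) → 1 ≤ ∣ U ∣ → Σ ℕ λ v → mem U v ≡ true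
  element (true ∷ U)  le = 0 , refl
  element (false ∷ U) le with element U le
  ... | v , eq = suc v , eq

  ∣∣≡0⇒≡⊥ : ∀ {n} (U : Subset n) → ∣ U ∣ ≡ 0 → U ≡ ⊥
  ∣∣≡0⇒≡⊥ []          eq = refl
  ∣∣≡0⇒≡⊥ (false ∷ U) eq = cong (false ∷_) (∣∣≡0⇒≡⊥ U eq)

  -- The Kleitman–Winston recursion: branching on a vertex v of large degree,
  -- either v is discarded or all its neighbours are.  Writing z = r/m₀ and
  -- λ = 1 + r/n, the number L of sets of size s surviving in U obeys
  -- L z^s ≤ (1 + z)^m₀ λ^|U|, because λ^β (λ - 1) ≥ z.
  module Containers {n : ℕ} (Independent : Subset n → Set)
    (hereditary : ∀ I J → J ⊑ I → Independent I → Independent J) (β m₀ r : ℕ)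
    (expansion : n * n ^ β ≤ m₀ * (n + r) ^ β)
    (rich : ∀ U → m₀ < ∣ U ∣ → Σ ℕ λ v → (mem U v ≡ true) × (Σ (Subset n) λ U′ → (suc (∣ U′ ∣ + β) ≤ ∣ U ∣) ×
      (∀ I → Independent I → I ⊑ U → mem I v ≡ true → remove v I ⊑ U′))) where

    -- The list may hold further sets and repetitions: only an upper bound for its length is wanted.
    Cover : Subset n → ℕ → List (Subset n) → Set
    Cover U s ℓ = ∀ I → Independent I → I ⊑ U → ∣ I ∣ ≡ s → I ∈ˡ ℓ

    cover-0 : ∀ U → Cover U 0 (⊥ ∷ [])
    cover-0 U I _ _ eq = here (∣∣≡0⇒≡⊥ I eq)

    cover-empty : ∀ U s → ∣ U ∣ ≤ 0 → Cover U (suc s) []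
    cover-empty U s U≤0 I _ I⊑U eq with subst (_≤ 0) eq (≤-trans (⊑⇒∣∣≤ I U I⊑U) U≤0)
    ... | ()

    cover-branch : ∀ U U′ v {s ℓ₁ ℓ₂} → (∀ I → Independent I → I ⊑ U → mem I v ≡ true → remove v I ⊑ U′) →
      Cover (remove v U) (suc s) ℓ₁ → Cover U′ s ℓ₂ → Cover U (suc s) (ℓ₁ ++ map (insert v) ℓ₂)
    cover-branch U U′ v {s} {ℓ₁} {ℓ₂} nbrs cov₁ cov₂ I ind I⊑U size = cases (mem I v) refl
      where
      cases : ∀ b → mem I v ≡ b → I ∈ˡ ℓ₁ ++ map (insert v) ℓ₂
      cases false eq = ∈-++⁺ˡ (cov₁ I ind I⊑ size)
        where
        I⊑ : I ⊑ remove v U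
        I⊑ y my = trans (mem-remove-≢ v y U (λ y≡v → true≢false (trans (sym my) (trans (cong (mem I) y≡v) eq)))) (I⊑U y my)
          where
          true≢false : true ≢ false
          true≢false ()
      cases true eq = ∈-++⁺ʳ ℓ₁ (subst (_∈ˡ map (insert v) ℓ₂) (insert-remove v I eq)
        (∈-map⁺ (insert v) (cov₂ (remove v I) (hereditary I (remove v I) (λ y my → proj₂ (mem-remove⁻ v y I my)) ind)
          (nbrs I ind I⊑U eq) (suc-injective (trans (∣remove∣ v I eq) size)))))

    length-branch : ∀ ℓ₁ ℓ₂ v → length (ℓ₁ ++ map (insert {n} v) ℓ₂) ≡ length ℓ₁ + length ℓ₂
    length-branch ℓ₁ ℓ₂ v = trans (length-++ ℓ₁) (cong (length ℓ₁ +_) (length-map (insert v) ℓ₂))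

    -- Branching on one element after another lists all s-subsets, and Pascal's recursion gives
    -- binom(u, s) z^s ≤ (1 + z)^u with z = r/m₀. This takes over once `U` has at most m₀ elements
    -- and `rich` no longer supplies a vertex.
    small-cover : ∀ u U s → ∣ U ∣ ≤ u → Σ (List (Subset n)) λ ℓ → Cover U s ℓ ×
      (length ℓ * (r ^ s * m₀ ^ u) ≤ m₀ ^ s * (m₀ + r) ^ u)
    small-cover u U zero U≤u = ⊥ ∷ [] , cover-0 U ,
      ≤-trans (≤-reflexive (trans (*-identityˡ _) (*-identityˡ (m₀ ^ u)))) (≤-trans (^-monoˡ-≤ u (m≤m+n m₀ r)) (≤-reflexive (sym (*-identityˡ _))))
    small-cover zero U (suc s) U≤0 = [] , cover-empty U s U≤0 , z≤n
    small-cover (suc u) U (suc s) U≤u with 1 ≤? ∣ U ∣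
    ... | no 1≰U = [] , cover-empty U s (≤-pred (≰⇒> 1≰U)) , z≤n
    ... | yes 1≤U with element U 1≤U
    ...   | v , v∈U with small-cover u (remove v U) (suc s) (removed v v∈U) | small-cover u (remove v U) s (removed v v∈U)
      where
      removed : ∀ v → mem U v ≡ true → ∣ remove v U ∣ ≤ u
      removed v v∈U = ≤-pred (subst (_≤ suc u) (sym (∣remove∣ v U v∈U)) U≤u)
    ...     | ℓ₁ , cov₁ , le₁ | ℓ₂ , cov₂ , le₂ = ℓ₁ ++ map (insert v) ℓ₂ , cover-branch U (remove v U) v nbrs cov₁ cov₂ , bound
      where
      open ≤-Reasoning
      nbrs : ∀ I → Independent I → I ⊑ U → mem I v ≡ true → remove v I ⊑ remove v U
      nbrs I _ I⊑U _ y my with mem-remove⁻ v y I my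
      ... | y≢v , my′ = trans (mem-remove-≢ v y U y≢v) (I⊑U y my′)
      eq₁ : ∀ L₁ L₂ r R m X → (L₁ + L₂) * (r * R * (m * X)) ≡ m * (L₁ * (r * R * X)) + m * r * (L₂ * (R * X))
      eq₁ = solve-∀
      eq₂ : ∀ m r S Y → m * (m * S * Y) + m * r * (S * Y) ≡ m * S * ((m + r) * Y)
      eq₂ = solve-∀
      bound : length (ℓ₁ ++ map (insert v) ℓ₂) * (r ^ suc s * m₀ ^ suc u) ≤ m₀ ^ suc s * (m₀ + r) ^ suc u
      bound = begin
        length (ℓ₁ ++ map (insert v) ℓ₂) * (r ^ suc s * m₀ ^ suc u)
          ≡⟨ cong (_* (r ^ suc s * m₀ ^ suc u)) (length-branch ℓ₁ ℓ₂ v) ⟩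
        (length ℓ₁ + length ℓ₂) * (r * r ^ s * (m₀ * m₀ ^ u))
          ≡⟨ eq₁ (length ℓ₁) (length ℓ₂) r (r ^ s) m₀ (m₀ ^ u) ⟩
        m₀ * (length ℓ₁ * (r ^ suc s * m₀ ^ u)) + m₀ * r * (length ℓ₂ * (r ^ s * m₀ ^ u))
          ≤⟨ +-mono-≤ (*-monoʳ-≤ m₀ le₁) (*-monoʳ-≤ (m₀ * r) le₂) ⟩
        m₀ * (m₀ ^ suc s * (m₀ + r) ^ u) + m₀ * r * (m₀ ^ s * (m₀ + r) ^ u)
          ≡⟨ eq₂ m₀ r (m₀ ^ s) ((m₀ + r) ^ u) ⟩
        m₀ ^ suc s * (m₀ + r) ^ suc u ∎

    Bound : Subset n → ℕ → ℕ → Set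
    Bound U s w = Σ (List (Subset n)) λ ℓ → Cover U s ℓ ×
      (length ℓ * (r ^ s * m₀ ^ m₀ * n ^ w) ≤ m₀ ^ s * (m₀ + r) ^ m₀ * (n + r) ^ w)

    from-small : ∀ U s w → (Σ (List (Subset n)) λ ℓ → Cover U s ℓ × (length ℓ * (r ^ s * m₀ ^ m₀) ≤ m₀ ^ s * (m₀ + r) ^ m₀)) → Bound U s w
    from-small U s w (ℓ , cov , le) = ℓ , cov ,
      ≤-trans (≤-reflexive (sym (*-assoc (length ℓ) (r ^ s * m₀ ^ m₀) (n ^ w)))) (*-mono-≤ le (^-monoˡ-≤ w (m≤m+n n r)))

    -- In terms of z and λ, discarding v contributes λ^w, and keeping it z λ^(w-β) ≤ (λ - 1) λ^w by
    -- `expansion`; together they make λ^(w+1).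
    branch-bound : ∀ s w L₁ L₂ → β ≤ w →
      L₁ * (r ^ suc s * m₀ ^ m₀ * n ^ w) ≤ m₀ ^ suc s * (m₀ + r) ^ m₀ * (n + r) ^ w →
      L₂ * (r ^ s * m₀ ^ m₀ * n ^ (w ∸ β)) ≤ m₀ ^ s * (m₀ + r) ^ m₀ * (n + r) ^ (w ∸ β) →
      (L₁ + L₂) * (r ^ suc s * m₀ ^ m₀ * n ^ suc w) ≤ m₀ ^ suc s * (m₀ + r) ^ m₀ * (n + r) ^ suc w
    branch-bound s w L₁ L₂ β≤w le₁ le₂ = begin
      (L₁ + L₂) * (r ^ suc s * X * n ^ suc w)
        ≡⟨ *-distribʳ-+ (r ^ suc s * X * n ^ suc w) L₁ L₂ ⟩
      L₁ * (r ^ suc s * X * n ^ suc w) + L₂ * (r ^ suc s * X * n ^ suc w)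
        ≡⟨ cong₂ _+_ (eq₁ L₁ (r ^ suc s * X) n (n ^ w)) (trans (cong (λ z → L₂ * (r ^ suc s * X * (n * z))) (split n)) (eq₂ L₂ r (r ^ s) X n (n ^ w₂) (n ^ β))) ⟩
      n * (L₁ * (r ^ suc s * X * n ^ w)) + r * (n * n ^ β) * (L₂ * (r ^ s * X * n ^ w₂))
        ≤⟨ +-mono-≤ (*-monoʳ-≤ n le₁) (*-mono-≤ (*-monoʳ-≤ r expansion) le₂) ⟩
      n * (m₀ ^ suc s * Y * (n + r) ^ w) + r * (m₀ * (n + r) ^ β) * (m₀ ^ s * Y * (n + r) ^ w₂)
        ≡⟨ cong (n * (m₀ ^ suc s * Y * (n + r) ^ w) +_) (trans (eq₃ r m₀ ((n + r) ^ β) (m₀ ^ s) Y ((n + r) ^ w₂))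
             (cong (λ z → r * (m₀ ^ suc s * Y * z)) (sym (split (n + r))))) ⟩
      n * (m₀ ^ suc s * Y * (n + r) ^ w) + r * (m₀ ^ suc s * Y * (n + r) ^ w)
        ≡⟨ eq₄ n r (m₀ ^ suc s * Y) ((n + r) ^ w) ⟩
      m₀ ^ suc s * Y * ((n + r) * (n + r) ^ w) ∎
      where
      open ≤-Reasoning
      X = m₀ ^ m₀
      Y = (m₀ + r) ^ m₀
      w₂ = w ∸ β
      split : ∀ a → a ^ w ≡ a ^ w₂ * a ^ β
      split a = trans (cong (a ^_) (sym (m∸n+n≡m β≤w))) (^-distribˡ-+-* a w₂ β)
      eq₁ : ∀ L R n N → L * (R * (n * N)) ≡ n * (L * (R * N))
      eq₁ = solve-∀
      eq₂ : ∀ L r R X n N B → L * (r * R * X * (n * (N * B))) ≡ r * (n * B) * (L * (R * X * N))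
      eq₂ = solve-∀
      eq₃ : ∀ r m B S Y N → r * (m * B) * (S * Y * N) ≡ r * (m * S * Y * (N * B))
      eq₃ = solve-∀
      eq₄ : ∀ n r Z N → n * (Z * N) + r * (Z * N) ≡ Z * ((n + r) * N)
      eq₄ = solve-∀

    -- `fuel` makes the recursion structural, as the branch that keeps v jumps from `suc w` to
    -- `w ∸ β`.
    cover : ∀ fuel w U s → w ≤ fuel → ∣ U ∣ ≤ w → Bound U s w
    cover fuel w U s w≤fuel U≤w with ∣ U ∣ ≤? m₀
    ... | yes U≤m₀ = from-small U s w (small-cover m₀ U s U≤m₀)
    cover fuel w U zero w≤fuel U≤w | no _ = from-small U 0 w small-base
      where
      small-base : Σ (List (Subset n)) λ ℓ → Cover U 0 ℓ × (length ℓ * (1 * m₀ ^ m₀) ≤ 1 * (m₀ + r) ^ m₀)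
      small-base = ⊥ ∷ [] , cover-0 U , ≤-trans (≤-reflexive (*-identityˡ _)) (*-monoʳ-≤ 1 (^-monoˡ-≤ m₀ (m≤m+n m₀ r)))
    cover fuel zero U (suc s) w≤fuel U≤w | no U≰m₀ = ⊥-elim (U≰m₀ (≤-trans U≤w z≤n))
    cover (suc fuel) (suc w) U (suc s) (s≤s w≤fuel) U≤w | no U≰m₀ with rich U (≰⇒> U≰m₀)
    ... | v , v∈U , U′ , U′β≤U , nbrs = join
          (cover fuel w (remove v U) (suc s) w≤fuel (≤-pred (subst (_≤ suc w) (sym (∣remove∣ v U v∈U)) U≤w)))
          (cover fuel (w ∸ β) U′ s (≤-trans (m∸n≤m w β) w≤fuel) (m+n≤o⇒m≤o∸n ∣ U′ ∣ U′β≤w))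
      where
      U′β≤w : ∣ U′ ∣ + β ≤ w
      U′β≤w = ≤-pred (≤-trans U′β≤U U≤w)
      join : Bound (remove v U) (suc s) w → Bound U′ s (w ∸ β) → Bound U (suc s) (suc w)
      join (ℓ₁ , cov₁ , le₁) (ℓ₂ , cov₂ , le₂) = ℓ₁ ++ map (insert v) ℓ₂ , cover-branch U U′ v nbrs cov₁ cov₂ ,
        subst (λ L → L * (r ^ suc s * m₀ ^ m₀ * n ^ suc w) ≤ m₀ ^ suc s * (m₀ + r) ^ m₀ * (n + r) ^ suc w) (sym (length-branch ℓ₁ ℓ₂ v))
          (branch-bound s w (length ℓ₁) (length ℓ₂) (≤-trans (m≤n+m β ∣ U′ ∣) U′β≤w) le₁ le₂)

-- Counting the r-subsets that contain a given set.

module Counting where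

  open Polynomials using (^-distribʳ-*)
  open import Data.Bool using (true; false)
  open import Data.Nat
  open import Data.Nat.Properties
  open import Data.Nat.Combinatorics using (_C_; nCk+nC[k+1]≡[n+1]C[k+1]; nC1≡n; k>n⇒nCk≡0)
  open import Data.Nat.Tactic.RingSolver using (solve-∀)
  open import Data.Fin.Subset using (Subset; _⊆_; ∣_∣; inside; outside)
  open import Data.Fin.Subset.Properties using (_⊆?_; p⊆q⇒∣p∣≤∣q∣; drop-∷-⊆; ∣p∣≤n)
  open import Data.Vec using ([]; _∷_; here; there)
  import Data.Vec.Properties as Vecₚ
  open import Data.List using (List; []; _∷_; _++_; map; length; filter)
  open import Data.List.Properties using (length-++; length-map; filter-++; filter-none)
  open import Data.List.Relation.Unary.All as All using (All; []; _∷_)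
  import Data.List.Relation.Unary.All.Properties as Allₚ
  open import Data.List.Relation.Unary.Any using (Any; here; there; any?)
  open import Data.List.Relation.Unary.Unique.Propositional using (Unique; []; _∷_)
  import Data.List.Relation.Unary.Unique.Propositional.Properties as Uniqueₚ
  open import Data.List.Membership.Propositional using (_∈_)
  open import Data.List.Membership.Propositional.Properties using (∈-map⁻)
  open import Data.Product using (Σ; _×_; _,_)
  open import Data.Sum using (_⊎_; inj₁; inj₂)
  open import Data.Empty using (⊥-elim)
  open import Function using (_∘_)
  open import Relation.Nullary using (¬_; yes; no)
  open import Relation.Nullary.Decidable using (¬?)
  open import Relation.Unary using (Decidable; Pred)
  open import Level using (0ℓ)
  open import Relation.Binary.PropositionalEquality

  absorption : ∀ n k → suc k * (suc n C suc k) ≡ suc n * (n C k)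
  absorption zero    zero    = refl
  absorption zero    (suc k) = trans (cong (suc (suc k) *_) (k>n⇒nCk≡0 {1} {suc (suc k)} (s≤s (s≤s z≤n))))
    (trans (*-zeroʳ k) (sym (cong (1 *_) (k>n⇒nCk≡0 {0} {suc k} (s≤s z≤n)))))
  absorption (suc n) zero    = trans (cong (1 *_) (nC1≡n (suc (suc n)))) (*-comm 1 (suc (suc n)))
  absorption (suc n) (suc k) = begin
    suc (suc k) * (suc (suc n) C suc (suc k))
      ≡⟨ cong (suc (suc k) *_) (sym (nCk+nC[k+1]≡[n+1]C[k+1] (suc n) (suc k))) ⟩
    suc (suc k) * (x + suc n C suc (suc k))
      ≡⟨ eq₁ (suc k) x (suc n C suc (suc k)) ⟩
    x + suc k * x + suc (suc k) * (suc n C suc (suc k))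
      ≡⟨ cong₂ (λ a b → x + a + b) (absorption n k) (absorption n (suc k)) ⟩
    x + suc n * (n C k) + suc n * (n C suc k)
      ≡⟨ eq₂ x (suc n) (n C k) (n C suc k) ⟩
    x + suc n * (n C k + n C suc k)
      ≡⟨ cong (λ a → x + suc n * a) (nCk+nC[k+1]≡[n+1]C[k+1] n k) ⟩
    suc (suc n) * x ∎
    where
    open ≡-Reasoning
    x = suc n C suc k
    eq₁ : ∀ k x y → suc k * (x + y) ≡ x + k * x + suc k * y
    eq₁ = solve-∀
    eq₂ : ∀ x n a b → x + n * a + n * b ≡ x + n * (a + b)
    eq₂ = solve-∀

  -- The quotient of the binomials is the product of (r + i)/(n + i) for 1 ≤ i ≤ t. As r ≤ n these
  -- factors increase with i, so each is at most the last.
  binomial-ratio : ∀ t n r → r ≤ n → (n C r) * (t + n) ^ t ≤ (t + r) ^ t * ((t + n) C (t + r))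
  binomial-ratio zero    n r r≤n = ≤-reflexive (*-comm (n C r) 1)
  binomial-ratio (suc t) n r r≤n = begin
    (n C r) * (suc N * suc N ^ t)        ≡⟨ eq₁ (n C r) (suc N) (suc N ^ t) ⟩
    suc N * ((n C r) * suc N ^ t)        ≤⟨ *-monoʳ-≤ (suc N) (core t refl (binomial-ratio t n r r≤n)) ⟩
    suc N * (suc R ^ t * (N C R))        ≡⟨ eq₁ (suc N) (suc R ^ t) (N C R) ⟩
    suc R ^ t * (suc N * (N C R))        ≡⟨ cong (suc R ^ t *_) (sym (absorption N R)) ⟩
    suc R ^ t * (suc R * (suc N C suc R)) ≡⟨ eq₂ (suc R ^ t) (suc R) (suc N C suc R) ⟩
    suc R * suc R ^ t * (suc N C suc R)  ∎
    where
    open ≤-Reasoning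
    N = t + n
    R = t + r
    eq₁ : ∀ a b c → a * (b * c) ≡ b * (a * c)
    eq₁ = solve-∀
    eq₂ : ∀ a b c → a * (b * c) ≡ b * a * c
    eq₂ = solve-∀
    cross : suc N * R ≤ suc R * N
    cross = ≤-trans (+-monoˡ-≤ (N * R) (+-monoʳ-≤ t r≤n)) (≤-reflexive (cong (N +_) (*-comm N R)))
    -- Raises the ratio R/N to (R + 1)/(N + 1). For t = 0 the number R may vanish and could not be
    -- cancelled, hence the case split.
    core : ∀ t′ → t′ ≡ t → (n C r) * N ^ t′ ≤ R ^ t′ * (N C R) → (n C r) * suc N ^ t′ ≤ suc R ^ t′ * (N C R)
    core zero      _   ih = ih
    core t′@(suc u) eq ih = *-cancelʳ-≤ _ _ (R ^ t′) {{m^n≢0 R t′ {{R≢0 eq}}}} (begin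
      (n C r) * suc N ^ t′ * R ^ t′        ≡⟨ trans (*-assoc (n C r) _ _) (cong ((n C r) *_) (sym (^-distribʳ-* (suc N) R t′))) ⟩
      (n C r) * (suc N * R) ^ t′           ≤⟨ *-monoʳ-≤ (n C r) (^-monoˡ-≤ t′ cross) ⟩
      (n C r) * (suc R * N) ^ t′           ≡⟨ trans (cong ((n C r) *_) (^-distribʳ-* (suc R) N t′)) (eq₁ (n C r) (suc R ^ t′) (N ^ t′)) ⟩
      suc R ^ t′ * ((n C r) * N ^ t′)      ≤⟨ *-monoʳ-≤ (suc R ^ t′) ih ⟩
      suc R ^ t′ * (R ^ t′ * (N C R))      ≡⟨ trans (cong (suc R ^ t′ *_) (*-comm (R ^ t′) (N C R))) (sym (*-assoc (suc R ^ t′) (N C R) (R ^ t′))) ⟩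
      suc R ^ t′ * (N C R) * R ^ t′        ∎)
      where
      R≢0 : suc u ≡ t → NonZero R
      R≢0 refl = _

  combinations : ∀ n (r : ℕ) → List (Subset n)
  combinations zero    zero    = [] ∷ []
  combinations zero    (suc r) = []
  combinations (suc n) zero    = map (outside ∷_) (combinations n zero)
  combinations (suc n) (suc r) = map (inside ∷_) (combinations n r) ++ map (outside ∷_) (combinations n (suc r))

  length-combinations : ∀ n r → length (combinations n r) ≡ n C r
  length-combinations zero    zero    = refl
  length-combinations zero    (suc r) = sym (k>n⇒nCk≡0 {0} {suc r} (s≤s z≤n))
  length-combinations (suc n) zero    = trans (length-map (outside ∷_) (combinations n 0)) (length-combinations n 0)
  length-combinations (suc n) (suc r) = trans (length-++ (map (inside ∷_) (combinations n r)))
    (trans (cong₂ _+_ (trans (length-map (inside ∷_) (combinations n r)) (length-combinations n r))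
                      (trans (length-map (outside ∷_) (combinations n (suc r))) (length-combinations n (suc r))))
           (nCk+nC[k+1]≡[n+1]C[k+1] n r))

  combinations-size : ∀ n r → All (λ R → ∣ R ∣ ≡ r) (combinations n r)
  combinations-size zero    zero    = refl ∷ []
  combinations-size zero    (suc r) = []
  combinations-size (suc n) zero    = Allₚ.map⁺ (combinations-size n 0)
  combinations-size (suc n) (suc r) = Allₚ.++⁺ (Allₚ.map⁺ (All.map (cong suc) (combinations-size n r)))
                                               (Allₚ.map⁺ (combinations-size n (suc r)))

  combinations-unique : ∀ n r → Unique (combinations n r)
  combinations-unique zero    zero    = [] ∷ []
  combinations-unique zero    (suc r) = []
  combinations-unique (suc n) zero    = Uniqueₚ.map⁺ Vecₚ.∷-injectiveʳ (combinations-unique n 0)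
  combinations-unique (suc n) (suc r) = Uniqueₚ.++⁺
    (Uniqueₚ.map⁺ Vecₚ.∷-injectiveʳ (combinations-unique n r))
    (Uniqueₚ.map⁺ Vecₚ.∷-injectiveʳ (combinations-unique n (suc r)))
    (λ { (p , q) → clash (∈-map⁻ (inside ∷_) p) (∈-map⁻ (outside ∷_) q) })
    where
    clash : ∀ {R : Subset (suc n)} {xs ys : List (Subset n)} →
      (Σ (Subset n) λ x → (x ∈ xs) × (R ≡ inside ∷ x)) → ¬ (Σ (Subset n) λ y → (y ∈ ys) × (R ≡ outside ∷ y))
    clash (_ , _ , refl) (_ , _ , ())

  module _ {A : Set} where

    count : {P : Pred A 0ℓ} → Decidable P → List A → ℕ
    count P? xs = length (filter P? xs)

    count-∪ : {P Q R : Pred A 0ℓ} (P? : Decidable P) (Q? : Decidable Q) (R? : Decidable R) →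
      (∀ x → R x → P x ⊎ Q x) → ∀ xs → count R? xs ≤ count P? xs + count Q? xs
    count-∪ P? Q? R? cov []       = z≤n
    count-∪ P? Q? R? cov (x ∷ xs) with count-∪ P? Q? R? cov xs | R? x | P? x | Q? x
    ... | ih | no _  | yes _ | yes _ = m≤n⇒m≤1+n (≤-trans ih (+-monoʳ-≤ (count P? xs) (n≤1+n (count Q? xs))))
    ... | ih | no _  | yes _ | no _  = m≤n⇒m≤1+n ih
    ... | ih | no _  | no _  | yes _ = ≤-trans ih (+-monoʳ-≤ (count P? xs) (n≤1+n (count Q? xs)))
    ... | ih | no _  | no _  | no _  = ih
    ... | ih | yes _ | yes _ | yes _ = s≤s (≤-trans ih (+-monoʳ-≤ (count P? xs) (n≤1+n (count Q? xs))))
    ... | ih | yes _ | yes _ | no _  = s≤s ih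
    ... | ih | yes _ | no _  | yes _ = ≤-trans (s≤s ih) (≤-reflexive (sym (+-suc (count P? xs) (count Q? xs))))
    ... | ih | yes r | no ¬p | no ¬q with cov x r
    ...   | inj₁ p = ⊥-elim (¬p p)
    ...   | inj₂ q = ⊥-elim (¬q q)

    count-complement : {P : Pred A 0ℓ} (P? : Decidable P) → ∀ xs → length xs ≡ count (¬? ∘ P?) xs + count P? xs
    count-complement P? []       = refl
    count-complement P? (x ∷ xs) with count-complement P? xs | P? x
    ... | ih | yes _ = trans (cong suc ih) (sym (+-suc _ _))
    ... | ih | no _  = cong suc ih

  count-map : ∀ {A B : Set} {P : Pred B 0ℓ} {Q : Pred A 0ℓ} (P? : Decidable P) (Q? : Decidable Q) (f : A → B) →
    (∀ x → P (f x) → Q x) → ∀ xs → count P? (map f xs) ≤ count Q? xs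
  count-map P? Q? f imp []       = z≤n
  count-map P? Q? f imp (x ∷ xs) with count-map P? Q? f imp xs | P? (f x) | Q? x
  ... | ih | yes p | yes _ = s≤s ih
  ... | ih | yes p | no ¬q = ⊥-elim (¬q (imp x p))
  ... | ih | no _  | yes _ = m≤n⇒m≤1+n ih
  ... | ih | no _  | no _  = ih

  supersets : ∀ {n} → Subset n → ℕ → ℕ
  supersets {n} J r = count (J ⊆?_) (combinations n r)

  count-none : ∀ {A : Set} {P : Pred A 0ℓ} (P? : Decidable P) {xs} → All (¬_ ∘ P) xs → count P? xs ≡ 0
  count-none P? none = cong length (filter-none P? none)

  supersets-none : ∀ {n} (J : Subset n) r → r < ∣ J ∣ → supersets J r ≡ 0
  supersets-none {n} J r r<J = count-none (J ⊆?_)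
    (All.map (λ { refl J⊆R → <⇒≱ r<J (p⊆q⇒∣p∣≤∣q∣ J⊆R) }) (combinations-size n r))

  -- Pascal's rule on the first coordinate: if it lies in `J`, only the sets containing it count;
  -- otherwise both halves of `combinations` contribute.
  supersets-≤ : ∀ {n} (J : Subset n) r → supersets J (∣ J ∣ + r) ≤ (n ∸ ∣ J ∣) C r
  supersets-≤ [] zero    = ≤-refl
  supersets-≤ [] (suc r) = z≤n
  supersets-≤ {suc n} (true ∷ J) r = begin
    count ((true ∷ J) ⊆?_) (xs ++ ys)
      ≡⟨ trans (cong length (filter-++ ((true ∷ J) ⊆?_) xs ys)) (length-++ (filter ((true ∷ J) ⊆?_) xs)) ⟩
    count ((true ∷ J) ⊆?_) xs + count ((true ∷ J) ⊆?_) ys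
      ≡⟨ cong (count ((true ∷ J) ⊆?_) xs +_) (count-none ((true ∷ J) ⊆?_) {ys}
           (Allₚ.map⁺ {xs = combinations n (suc (∣ J ∣ + r))} (All.tabulate (λ {R} _ sub → absurd {R} (sub here))))) ⟩
    count ((true ∷ J) ⊆?_) xs + 0
      ≡⟨ +-identityʳ _ ⟩
    count ((true ∷ J) ⊆?_) xs
      ≤⟨ count-map ((true ∷ J) ⊆?_) (J ⊆?_) (inside ∷_) (λ _ → drop-∷-⊆) (combinations n (∣ J ∣ + r)) ⟩
    supersets J (∣ J ∣ + r)
      ≤⟨ supersets-≤ J r ⟩
    (n ∸ ∣ J ∣) C r ∎
    where
    open ≤-Reasoning
    xs = map (inside ∷_) (combinations n (∣ J ∣ + r))
    ys = map (outside ∷_) (combinations n (suc (∣ J ∣ + r)))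
    open import Data.Fin using (zero)
    absurd : ∀ {R : Subset n} → ¬ (zero Data.Fin.Subset.∈ (outside ∷ R))
    absurd ()
  supersets-≤ {suc n} (false ∷ J) r = outer (∣ J ∣ + r) refl
    where
    open ≤-Reasoning
    step : ∀ b ρ → count ((false ∷ J) ⊆?_) (map (b ∷_) (combinations n ρ)) ≤ supersets J ρ
    step b ρ = count-map ((false ∷ J) ⊆?_) (J ⊆?_) (b ∷_) (λ _ → drop-∷-⊆) (combinations n ρ)
    pascal : ∀ ρ → suc ρ ≡ ∣ J ∣ + r → supersets J ρ + supersets J (suc ρ) ≤ (suc n ∸ ∣ J ∣) C r
    pascal ρ eq = go r eq
      where
      go : ∀ r → suc ρ ≡ ∣ J ∣ + r → supersets J ρ + supersets J (suc ρ) ≤ (suc n ∸ ∣ J ∣) C r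
      -- Here ρ = |J| - 1, and no set that small contains `J`, so the first summand vanishes.
      go zero eq = begin
        supersets J ρ + supersets J (suc ρ)  ≡⟨ cong (_+ supersets J (suc ρ)) (supersets-none J ρ (≤-reflexive (trans eq (+-identityʳ _)))) ⟩
        supersets J (suc ρ)                  ≡⟨ cong (supersets J) eq ⟩
        supersets J (∣ J ∣ + 0)              ≤⟨ supersets-≤ J 0 ⟩
        (n ∸ ∣ J ∣) C 0                      ≡⟨⟩
        (suc n ∸ ∣ J ∣) C 0                  ∎
      go (suc r′) eq = begin
        supersets J ρ + supersets J (suc ρ)                        ≡⟨ cong₂ (λ a b → supersets J a + supersets J b) (suc-injective (trans eq (+-suc ∣ J ∣ r′))) eq ⟩
        supersets J (∣ J ∣ + r′) + supersets J (∣ J ∣ + suc r′)    ≤⟨ +-mono-≤ (supersets-≤ J r′) (supersets-≤ J (suc r′)) ⟩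
        (n ∸ ∣ J ∣) C r′ + (n ∸ ∣ J ∣) C suc r′                    ≡⟨ nCk+nC[k+1]≡[n+1]C[k+1] (n ∸ ∣ J ∣) r′ ⟩
        suc (n ∸ ∣ J ∣) C suc r′                                   ≡⟨ cong (_C suc r′) (sym (+-∸-assoc 1 (∣p∣≤n J))) ⟩
        (suc n ∸ ∣ J ∣) C suc r′                                   ∎
    outer : ∀ R → R ≡ ∣ J ∣ + r → supersets (false ∷ J) R ≤ (suc n ∸ ∣ J ∣) C r
    outer zero eq = begin
      supersets (false ∷ J) 0      ≤⟨ step outside 0 ⟩
      supersets J 0                ≡⟨ cong (supersets J) eq ⟩
      supersets J (∣ J ∣ + r)      ≤⟨ supersets-≤ J r ⟩
      (n ∸ ∣ J ∣) C r              ≡⟨ cong₂ (λ a b → (n ∸ a) C b) (m+n≡0⇒m≡0 ∣ J ∣ (sym eq)) (m+n≡0⇒n≡0 ∣ J ∣ (sym eq)) ⟩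
      n C 0                        ≡⟨⟩
      suc n C 0                    ≡⟨ cong₂ (λ a b → (suc n ∸ a) C b) (sym (m+n≡0⇒m≡0 ∣ J ∣ (sym eq))) (sym (m+n≡0⇒n≡0 ∣ J ∣ (sym eq))) ⟩
      (suc n ∸ ∣ J ∣) C r          ∎
    outer (suc ρ) eq = begin
      count ((false ∷ J) ⊆?_) (map (inside ∷_) (combinations n ρ) ++ map (outside ∷_) (combinations n (suc ρ)))
        ≡⟨ trans (cong length (filter-++ ((false ∷ J) ⊆?_) (map (inside ∷_) (combinations n ρ)) (map (outside ∷_) (combinations n (suc ρ)))))
                 (length-++ (filter ((false ∷ J) ⊆?_) (map (inside ∷_) (combinations n ρ)))) ⟩
      count ((false ∷ J) ⊆?_) (map (inside ∷_) (combinations n ρ)) + count ((false ∷ J) ⊆?_) (map (outside ∷_) (combinations n (suc ρ)))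
        ≤⟨ +-mono-≤ (step inside ρ) (step outside (suc ρ)) ⟩
      supersets J ρ + supersets J (suc ρ)
        ≤⟨ pascal ρ eq ⟩
      (suc n ∸ ∣ J ∣) C r ∎

  supersets-ratio : ∀ {n} (J : Subset n) t r → ∣ J ∣ ≡ t → t ≤ r → r ≤ n → supersets J r * n ^ t ≤ r ^ t * (n C r)
  supersets-ratio {n} J t r refl t≤r r≤n with m≤n⇒∃[o]m+o≡n t≤r | m≤n⇒∃[o]m+o≡n (≤-trans t≤r r≤n)
  ... | r′ , refl | n′ , eq = begin
    supersets J (t + r′) * n ^ t            ≤⟨ *-monoˡ-≤ (n ^ t) (supersets-≤ J r′) ⟩
    ((n ∸ t) C r′) * n ^ t                  ≡⟨ cong₂ (λ a b → (a C r′) * b ^ t) (trans (cong (_∸ t) (sym eq)) (m+n∸m≡n t n′)) (sym eq) ⟩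
    (n′ C r′) * (t + n′) ^ t                ≤⟨ binomial-ratio t n′ r′ (+-cancelˡ-≤ t r′ n′ (≤-trans r≤n (≤-reflexive (sym eq)))) ⟩
    (t + r′) ^ t * ((t + n′) C (t + r′))    ≡⟨ cong (λ a → (t + r′) ^ t * (a C (t + r′))) eq ⟩
    (t + r′) ^ t * (n C (t + r′))           ∎
    where open ≤-Reasoning

  contains-any? : ∀ {n} (ℓ : List (Subset n)) → Decidable (λ R → Any (_⊆ R) ℓ)
  contains-any? ℓ R = any? (_⊆? R) ℓ

  union-bound : ∀ {n} t r (ℓ : List (Subset n)) → All (λ J → ∣ J ∣ ≡ t) ℓ → t ≤ r → r ≤ n →
    count (contains-any? ℓ) (combinations n r) * n ^ t ≤ length ℓ * (r ^ t * (n C r))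
  union-bound {n} t r [] [] t≤r r≤n = ≤-reflexive (cong (_* n ^ t) (count-none (contains-any? []) {combinations n r} (All.tabulate (λ _ ()))))
  union-bound {n} t r (J ∷ ℓ) (size ∷ sizes) t≤r r≤n = begin
    count (contains-any? (J ∷ ℓ)) xs * n ^ t
      ≤⟨ *-monoˡ-≤ (n ^ t) (count-∪ (J ⊆?_) (contains-any? ℓ) (contains-any? (J ∷ ℓ)) (λ { _ (here p) → inj₁ p ; _ (there p) → inj₂ p }) xs) ⟩
    (supersets J r + count (contains-any? ℓ) xs) * n ^ t
      ≡⟨ *-distribʳ-+ (n ^ t) (supersets J r) (count (contains-any? ℓ) xs) ⟩
    supersets J r * n ^ t + count (contains-any? ℓ) xs * n ^ t
      ≤⟨ +-mono-≤ (supersets-ratio J t r size t≤r r≤n) (union-bound t r ℓ sizes t≤r r≤n) ⟩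
    r ^ t * (n C r) + length ℓ * (r ^ t * (n C r)) ∎
    where
    open ≤-Reasoning
    xs = combinations n r

-- From containers to random sparse sets.

module SparseSets where

  open import Defs
  open IntegerSums using (∑; ∑-head)
  open Polynomials using (^-distribʳ-*)
  open DensityTheorem
  open Varnavides
  open Estimates
  open IndependentSets
  open Counting
  open import Data.Bool using (true; false)
  open import Data.Nat
  open import Data.Nat.Properties
  open import Data.Nat.DivMod using (m≡m%n+[m/n]*n; m%n<n; m/n*n≤m; m≥n⇒m/n>0)
  open import Data.Nat.Combinatorics using (_C_)
  open import Data.Nat.Tactic.RingSolver using (solve-∀)
  import Data.Integer as ℤ
  import Data.Integer.Properties as ℤₚ
  import Data.Integer.Tactic.RingSolver as ℤ-Solver
  open import Data.Fin using (toℕ)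
  open import Data.Fin.Properties using (toℕ<n)
  open import Data.Fin.Subset using (Subset; _⊆_; ∣_∣; inside; outside; ⊤)
  open import Data.Fin.Subset.Properties using (∈⊤; ∣⊤∣≡n; out⊆; in⊆in)
  open import Data.Vec using ([]; _∷_)
  open import Data.List using (List; []; _∷_; length; filter)
  open import Data.List.Properties using (length-filter)
  open import Data.List.Relation.Unary.All as All using (All)
  import Data.List.Relation.Unary.All.Properties as Allₚ
  open import Data.List.Relation.Unary.Any using (Any)
  open import Data.List.Membership.Propositional using (lose) renaming (_∈_ to _∈ˡ_)
  open import Data.List.Membership.Propositional.Properties using (∈-filter⁺)
  import Data.List.Relation.Unary.Unique.Propositional.Properties as Uniqueₚ
  open import Data.Product using (Σ; _×_; _,_; proj₁; proj₂)
  open import Function using (_∘_)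
  open import Relation.Nullary using (¬_; yes; no; Dec)
  open import Relation.Nullary.Decidable using (¬?; map′; decidable-stable)
  open import Relation.Binary.PropositionalEquality

  powerPair⇒ : ∀ {n} k (I : Subset n) → PowerPair k n (mem I) → HasPowerPair k I
  powerPair⇒ k I (y , e , _ , my , mz) with mem⇒Fin I y my | mem⇒Fin I (y + suc e ^ k) mz
  ... | i , eqᵢ , i∈I | j , eqⱼ , j∈I = i , j , suc e , s≤s z≤n , i∈I , j∈I , trans eqⱼ (cong (_+ suc e ^ k) (sym eqᵢ))

  powerPair⇐ : ∀ {n} k (I : Subset n) → HasPowerPair k I → PowerPair k n (mem I)
  powerPair⇐ {n} k I (i , j , suc e , _ , i∈I , j∈I , eq) =
    toℕ i , e , subst (_< n) eq (toℕ<n j) , ∈⇒mem i∈I , trans (cong (mem I) (sym eq)) (∈⇒mem j∈I)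

  hasPowerPair? : ∀ {n} k (I : Subset n) → Dec (HasPowerPair (suc k) I)
  hasPowerPair? {n} k I = map′ (powerPair⇒ (suc k) I) (powerPair⇐ (suc k) I) (powerPair? k n (mem I))

  HasPowerPair-mono : ∀ {n} k {I J : Subset n} → J ⊆ I → HasPowerPair k J → HasPowerPair k I
  HasPowerPair-mono k J⊆I (i , j , d , 1≤d , i∈J , j∈J , eq) = i , j , d , 1≤d , J⊆I i∈J , J⊆I j∈J , eq

  ⊑⇒⊆ : ∀ {n} (J I : Subset n) → J ⊑ I → J ⊆ I
  ⊑⇒⊆ J I J⊑I {i} i∈J = mem⇒∈ I i (J⊑I (toℕ i) (∈⇒mem i∈J))

  shrink : ∀ {n} (A : Subset n) t → t ≤ ∣ A ∣ → Σ (Subset n) λ J → (J ⊆ A) × (∣ J ∣ ≡ t)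
  shrink []          zero    _        = [] , (λ ()) , refl
  shrink (false ∷ A) t       t≤A      with shrink A t t≤A
  ... | J , J⊆A , size = outside ∷ J , out⊆ J⊆A , size
  shrink (true ∷ A)  zero    _        with shrink A zero z≤n
  ... | J , J⊆A , size = outside ∷ J , out⊆ J⊆A , size
  shrink (true ∷ A)  (suc t) (s≤s le) with shrink A t le
  ... | J , J⊆A , size = inside ∷ J , in⊆in J⊆A , cong suc size

  -- The number ⌈r/q⌉ with its two uses: r ≤ q t makes 32^r at most A^t, and minimality puts a t-set
  -- inside every large subset.
  ceiling : ∀ q → 1 ≤ q → ∀ r → Σ ℕ λ t → (r ≤ q * t) × (∀ a → r ≤ q * a → t ≤ a)
  ceiling q 1≤q zero    = 0 , z≤n , λ _ _ → z≤n
  ceiling q 1≤q (suc r) with ceiling q 1≤q r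
  ... | t , r≤qt , least with suc r ≤? q * t
  ...   | yes r<qt = t , r<qt , λ a r<qa → least a (<⇒≤ r<qa)
  ...   | no r≮qt  = suc t , subst (suc r ≤_) (sym (*-suc q t)) (+-mono-≤ 1≤q r≤qt) ,
                     λ a r<qa → *-cancelˡ-< q t a (≤-<-trans (≮⇒≥ r≮qt) r<qa)

  -- Why 1/(4A): `rich` concerns sets of more than n/A elements; padding by `gap` ≤ n halves their
  -- density, and `Supersaturation` wants twice the density of `rec`.
  module Sparse (k A N₀ : ℕ) (1≤A : 1 ≤ A) (1≤N₀ : 1 ≤ N₀) (rec : Recurrent (suc k) (4 * A) 1 N₀)
    (n r β : ℕ) (A≤n : A ≤ n) (1≤β : 1 ≤ β)
    (gap≤n : (4 * A * (N₀ * N₀) * β * N₀) ^ suc k ≤ n) (degree : 2 * A * n ≤ r * β) where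

    instance
      A≢0 : NonZero A
      A≢0 = >-nonZero 1≤A
      n≢0 : NonZero n
      n≢0 = >-nonZero (≤-trans 1≤A A≤n)

    m₀ : ℕ
    m₀ = n / A

    instance
      m₀≢0 : NonZero m₀
      m₀≢0 = >-nonZero (m≥n⇒m/n>0 A≤n)

    n<[1+m₀]A : n < suc m₀ * A
    n<[1+m₀]A = begin-strict
      n                   ≡⟨ m≡m%n+[m/n]*n n A ⟩
      n % A + m₀ * A      <⟨ +-monoˡ-< (m₀ * A) (m%n<n n A) ⟩
      A + m₀ * A          ∎
      where open ≤-Reasoning

    n≤2Am₀ : n ≤ 2 * A * m₀
    n≤2Am₀ = begin
      n                   ≤⟨ <⇒≤ n<[1+m₀]A ⟩
      A + m₀ * A          ≤⟨ +-monoˡ-≤ (m₀ * A) (m≤n*m A m₀) ⟩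
      m₀ * A + m₀ * A     ≡⟨ eq m₀ A ⟩
      2 * A * m₀          ∎
      where
      open ≤-Reasoning
      eq : ∀ m A → m * A + m * A ≡ 2 * A * m
      eq = solve-∀

    -- (1 + r/n)^β ≥ 1 + r β/n ≥ 2A ≥ n/m₀, where the factor 2 pays for rounding m₀ down.
    expansion : n * n ^ β ≤ m₀ * (n + r) ^ β
    expansion = *-cancelˡ-≤ n (begin
      n * (n * n ^ β)                 ≤⟨ *-monoˡ-≤ (n * n ^ β) n≤2Am₀ ⟩
      2 * A * m₀ * (n * n ^ β)        ≡⟨ eq₁ A m₀ n (n ^ β) ⟩
      m₀ * n ^ β * (2 * A * n)        ≤⟨ *-monoʳ-≤ (m₀ * n ^ β) (≤-trans degree (≤-trans (≤-reflexive (*-comm r β)) (m≤n+m (β * r) n))) ⟩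
      m₀ * n ^ β * (n + β * r)        ≡⟨ *-assoc m₀ (n ^ β) (n + β * r) ⟩
      m₀ * (n ^ β * (n + β * r))      ≤⟨ *-monoʳ-≤ m₀ (Bernoulli n r β) ⟩
      m₀ * (n * (n + r) ^ β)          ≡⟨ eq₂ m₀ n ((n + r) ^ β) ⟩
      n * (m₀ * (n + r) ^ β)          ∎)
      where
      open ≤-Reasoning
      eq₁ : ∀ A m n N → 2 * A * m * (n * N) ≡ m * N * (2 * A * n)
      eq₁ = solve-∀
      eq₂ : ∀ m n N → m * (n * N) ≡ n * (m * N)
      eq₂ = solve-∀

    Independent : Subset n → Set
    Independent I = ¬ HasPowerPair (suc k) I

    rich : ∀ U → m₀ < ∣ U ∣ → Σ ℕ λ v → (mem U v ≡ true) × (Σ (Subset n) λ U′ → (suc (∣ U′ ∣ + β) ≤ ∣ U ∣) ×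
      (∀ I → Independent I → I ⊑ U → mem I v ≡ true → remove v I ⊑ U′))
    rich U m₀<U = build (rich-vertex (mem U) dense)
      where
      open Supersaturation k (4 * A) N₀ (≤-trans 1≤A (m≤n*m A 4)) 1≤N₀ rec n β (≤-trans 1≤A A≤n) 1≤β
      denseℕ : 2 * (gap + n) ≤ 4 * A * ∣ U ∣
      denseℕ = begin
        2 * (gap + n)        ≤⟨ *-monoʳ-≤ 2 (+-monoˡ-≤ n gap≤n) ⟩
        2 * (n + n)          ≡⟨ eq n ⟩
        4 * n                ≤⟨ *-monoʳ-≤ 4 (<⇒≤ (<-≤-trans n<[1+m₀]A (*-monoˡ-≤ A m₀<U))) ⟩
        4 * (∣ U ∣ * A)      ≡⟨ trans (cong (4 *_) (*-comm ∣ U ∣ A)) (sym (*-assoc 4 A ∣ U ∣)) ⟩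
        4 * A * ∣ U ∣        ∎
        where
        open ≤-Reasoning
        eq : ∀ n → 2 * (n + n) ≡ 4 * n
        eq = solve-∀
      dense : ℤ.+ 2 ℤ.* ℤ.+ (gap + n) ℤ.≤ ℤ.+ (4 * A) ℤ.* ∑ n (ι ∘ mem U)
      dense = subst₂ ℤ._≤_ (ℤₚ.pos-* 2 (gap + n)) (trans (ℤₚ.pos-* (4 * A) ∣ U ∣) (cong (ℤ.+ (4 * A) ℤ.*_) (sym (∑-mem U)))) (ℤ.+≤+ denseℕ)
      build : RichVertex (mem U) dense → _
      build (v , e , _ , v∈U , many) = v , v∈U , U′ , ℤ.drop‿+≤+ size , nbrs
        where
        -- D = 0 gives v itself, so v is deleted together with its neighbours; hence the `suc` in
        -- the size bound.
        a : ℕ → ℕ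
        a D = v + (D * suc e) ^ suc k
        U′ : Subset n
        U′ = removeAll a (suc scales) U
        a-injective : ∀ i j → a i ≡ a j → i ≡ j
        a-injective i j eq = *-cancelʳ-≡ i j (suc e) (^-injectiveˡ k (+-cancelˡ-≡ v _ _ eq))
        head-term : ι (mem U (a 0)) ≡ ℤ.1ℤ
        head-term = cong ι (trans (cong (mem U) (+-identityʳ v)) v∈U)
        tail : ℤ.ℤ
        tail = ∑ scales (λ D → ι (mem U (a (suc D))))
        removed : ℤ.+ ∣ U′ ∣ ℤ.+ (ℤ.1ℤ ℤ.+ tail) ≡ ℤ.+ ∣ U ∣
        removed = trans (cong (ℤ._+_ (ℤ.+ ∣ U′ ∣)) (trans (cong (ℤ._+ tail) (sym head-term)) (sym (∑-head scales (λ D → ι (mem U (a D)))))))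
                        (∣removeAll∣ a a-injective (suc scales) U)
        rearr : ∀ u b → ℤ.1ℤ ℤ.+ (u ℤ.+ b) ≡ u ℤ.+ (ℤ.1ℤ ℤ.+ b)
        rearr = ℤ-Solver.solve-∀
        size : ℤ.+ suc (∣ U′ ∣ + β) ℤ.≤ ℤ.+ ∣ U ∣
        size = subst₂ ℤ._≤_ (sym (rearr (ℤ.+ ∣ U′ ∣) (ℤ.+ β))) removed (ℤₚ.+-monoʳ-≤ (ℤ.+ ∣ U′ ∣) (ℤₚ.+-monoʳ-≤ ℤ.1ℤ many))
        nbrs : ∀ I → Independent I → I ⊑ U → mem I v ≡ true → remove v I ⊑ U′
        nbrs I ind I⊑U v∈I y my = trans (mem-removeAll a (suc scales) y U avoids) (I⊑U y y∈I)
          where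
          y≢v = proj₁ (mem-remove⁻ v y I my)
          y∈I = proj₂ (mem-remove⁻ v y I my)
          avoids : ∀ D → D < suc scales → y ≢ a D
          avoids zero    _ y≡a = y≢v (trans y≡a (+-identityʳ v))
          avoids (suc D) _ y≡a with mem⇒Fin I v v∈I | mem⇒Fin I y y∈I
          ... | i , eqᵢ , i∈I | j , eqⱼ , j∈I = ind (i , j , suc D * suc e , s≤s z≤n , i∈I , j∈I ,
                trans eqⱼ (trans y≡a (cong (_+ (suc D * suc e) ^ suc k) (sym eqᵢ))))

    open Containers Independent (λ I J J⊑I ind pair → ind (HasPowerPair-mono (suc k) (⊑⇒⊆ J I J⊑I) pair)) β m₀ r expansion rich

    independent-sets : ∀ t → Σ (List (Subset n)) λ ℓ → Cover ⊤ t ℓ × (length ℓ * r ^ t ≤ m₀ ^ t * 16 ^ r)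
    independent-sets t = simplify (cover n n ⊤ t ≤-refl (≤-reflexive (∣⊤∣≡n n)))
      where
      open ≤-Reasoning
      eq₁ : ∀ a b c d → a * b * (c * d) ≡ a * (b * c * d)
      eq₁ = solve-∀
      eq₂ : ∀ a b c d → a * (b * c) * (b * d) ≡ a * (b * b) * (c * d)
      eq₂ = solve-∀
      simplify : Bound ⊤ t n → Σ (List (Subset n)) λ ℓ → Cover ⊤ t ℓ × (length ℓ * r ^ t ≤ m₀ ^ t * 16 ^ r)
      simplify (ℓ , cov , le) = ℓ , cov , *-cancelʳ-≤ _ _ (m₀ ^ m₀ * n ^ n) {{m*n≢0 (m₀ ^ m₀) (n ^ n) {{m^n≢0 m₀ m₀}} {{m^n≢0 n n}}}} (begin
        length ℓ * r ^ t * (m₀ ^ m₀ * n ^ n)             ≡⟨ eq₁ (length ℓ) (r ^ t) (m₀ ^ m₀) (n ^ n) ⟩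
        length ℓ * (r ^ t * m₀ ^ m₀ * n ^ n)             ≤⟨ le ⟩
        m₀ ^ t * (m₀ + r) ^ m₀ * (n + r) ^ n             ≤⟨ *-mono-≤ (*-monoʳ-≤ (m₀ ^ t) ([y+x]^y≤4^x*y^y m₀ r)) ([y+x]^y≤4^x*y^y n r) ⟩
        m₀ ^ t * (4 ^ r * m₀ ^ m₀) * (4 ^ r * n ^ n)     ≡⟨ eq₂ (m₀ ^ t) (4 ^ r) (m₀ ^ m₀) (n ^ n) ⟩
        m₀ ^ t * (4 ^ r * 4 ^ r) * (m₀ ^ m₀ * n ^ n)     ≡⟨ cong (λ z → m₀ ^ t * z * (m₀ ^ m₀ * n ^ n)) (sym (^-distribʳ-* 4 4 r)) ⟩
        m₀ ^ t * 16 ^ r * (m₀ ^ m₀ * n ^ n)              ∎)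

    FewBad : ℕ → Set
    FewBad t = Σ (List (Subset n)) λ ℓ → (∀ I → Independent I → ∣ I ∣ ≡ t → I ∈ˡ ℓ) ×
      (A ^ t * count (contains-any? ℓ) (combinations n r) ≤ 16 ^ r * (n C r))

    -- At most (m₀/r)^t 16^r sets are listed, each contained in a fraction at most (r/n)^t of the
    -- r-subsets. The powers of r cancel, and (m₀/n)^t ≤ A^(-t).
    few-bad : ∀ t → t ≤ r → r ≤ n → FewBad t
    few-bad t t≤r r≤n = restrict (independent-sets t)
      where
      open ≤-Reasoning
      size? : ∀ (J : Subset n) → Dec (∣ J ∣ ≡ t)
      size? J = ∣ J ∣ ≟ t
      eq₁ : ∀ a m s c → a * (m * s * c) ≡ m * a * (s * c)
      eq₁ = solve-∀
      ⊑⊤ : ∀ (I : Subset n) → I ⊑ ⊤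
      ⊑⊤ I y my with mem⇒Fin I y my
      ... | i , refl , _ = ∈⇒mem {U = ⊤} {i} ∈⊤
      restrict : (Σ (List (Subset n)) λ ℓ → Cover ⊤ t ℓ × (length ℓ * r ^ t ≤ m₀ ^ t * 16 ^ r)) → FewBad t
      restrict (ℓ , cov , le) = ℓ′ , (λ I ind size → ∈-filter⁺ size? (cov I ind (⊑⊤ I) size) size) ,
        *-cancelʳ-≤ _ _ (n ^ t) {{m^n≢0 n t}} (begin
          A ^ t * bad * n ^ t                          ≡⟨ *-assoc (A ^ t) bad (n ^ t) ⟩
          A ^ t * (bad * n ^ t)                        ≤⟨ *-monoʳ-≤ (A ^ t) (union-bound t r ℓ′ (Allₚ.all-filter size? ℓ) t≤r r≤n) ⟩
          A ^ t * (length ℓ′ * (r ^ t * (n C r)))      ≤⟨ *-monoʳ-≤ (A ^ t) (*-monoˡ-≤ (r ^ t * (n C r)) (length-filter size? ℓ)) ⟩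
          A ^ t * (length ℓ * (r ^ t * (n C r)))       ≡⟨ cong (A ^ t *_) (sym (*-assoc (length ℓ) (r ^ t) (n C r))) ⟩
          A ^ t * (length ℓ * r ^ t * (n C r))         ≤⟨ *-monoʳ-≤ (A ^ t) (*-monoˡ-≤ (n C r) le) ⟩
          A ^ t * (m₀ ^ t * 16 ^ r * (n C r))          ≡⟨ eq₁ (A ^ t) (m₀ ^ t) (16 ^ r) (n C r) ⟩
          (m₀ ^ t * A ^ t) * (16 ^ r * (n C r))        ≡⟨ cong (_* (16 ^ r * (n C r))) (sym (^-distribʳ-* m₀ A t)) ⟩
          (m₀ * A) ^ t * (16 ^ r * (n C r))            ≤⟨ *-monoˡ-≤ (16 ^ r * (n C r)) (^-monoˡ-≤ t (m/n*n≤m n A)) ⟩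
          n ^ t * (16 ^ r * (n C r))                   ≡⟨ *-comm (n ^ t) (16 ^ r * (n C r)) ⟩
          16 ^ r * (n C r) * n ^ t                     ∎)
        where
        ℓ′ = filter size? ℓ
        bad = count (contains-any? ℓ′) (combinations n r)

    mostDense : ∀ p q m → 1 ≤ p → 1 ≤ q → A ≡ 32 ^ q → m ≤ r → r ≤ n → MostDense (suc k) p q n r m
    mostDense p q m 1≤p 1≤q A≡ m≤r r≤n = collect (ceiling q 1≤q r)
      where
      Ceiling : Set
      Ceiling = Σ ℕ λ t → (r ≤ q * t) × (∀ a → r ≤ q * a → t ≤ a)
      module _ (t : ℕ) (r≤qt : r ≤ q * t) (least : ∀ a → r ≤ q * a → t ≤ a) (ℓ : List (Subset n))
        (covers : ∀ I → Independent I → ∣ I ∣ ≡ t → I ∈ˡ ℓ)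
        (le : A ^ t * count (contains-any? ℓ) (combinations n r) ≤ 16 ^ r * (n C r)) where
        good? = ¬? ∘ contains-any? ℓ
        good = filter good? (combinations n r)
        bad = count (contains-any? ℓ) (combinations n r)
        -- A large subset of R without a pair would have at least t elements, as p ≥ 1, and a
        -- t-subset of it would be listed in ℓ. Decidability removes the double negation.
        dense : ∀ {R} → ∣ R ∣ ≡ r → ¬ Any (_⊆ R) ℓ → Dense (suc k) p q R
        dense {R} size none B B⊆R large = decidable-stable (hasPowerPair? k B) (λ noPair →
          let J , J⊆B , sizeJ = shrink B t (least ∣ B ∣ (≤-trans (m≤n*m r p {{>-nonZero 1≤p}}) (subst (λ z → p * z ≤ q * ∣ B ∣) size large)))
          in none (lose (covers J (λ pair → noPair (HasPowerPair-mono (suc k) J⊆B pair)) sizeJ) (λ {x} x∈J → B⊆R (J⊆B x∈J))))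
        2^r*bad≤ : 2 ^ r * bad ≤ n C r
        2^r*bad≤ = *-cancelˡ-≤ (16 ^ r) {{m^n≢0 16 r}} (begin
          16 ^ r * (2 ^ r * bad)   ≡⟨ sym (*-assoc (16 ^ r) (2 ^ r) bad) ⟩
          16 ^ r * 2 ^ r * bad     ≡⟨ cong (_* bad) (sym (^-distribʳ-* 16 2 r)) ⟩
          32 ^ r * bad             ≤⟨ *-monoˡ-≤ bad (^-monoʳ-≤ 32 r≤qt) ⟩
          32 ^ (q * t) * bad       ≡⟨ cong (_* bad) (trans (sym (^-*-assoc 32 q t)) (cong (_^ t) (sym A≡))) ⟩
          A ^ t * bad              ≤⟨ le ⟩
          16 ^ r * (n C r)         ∎)
          where open ≤-Reasoning
        enough : m * (n C r) ≤ suc m * length good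
        enough = +-cancelʳ-≤ (suc m * bad) _ _ (begin
          m * (n C r) + suc m * bad            ≤⟨ +-monoʳ-≤ (m * (n C r)) (≤-trans (*-monoˡ-≤ bad (≤-trans (n<2^n m) (^-monoʳ-≤ 2 m≤r))) 2^r*bad≤) ⟩
          m * (n C r) + n C r                  ≡⟨ +-comm (m * (n C r)) (n C r) ⟩
          suc m * (n C r)                      ≡⟨ cong (suc m *_) (trans (sym (length-combinations n r)) (count-complement (contains-any? ℓ) (combinations n r))) ⟩
          suc m * (length good + bad)          ≡⟨ *-distribˡ-+ (suc m) (length good) bad ⟩
          suc m * length good + suc m * bad    ∎)
          where open ≤-Reasoning
        all-good : MostDense (suc k) p q n r m
        all-good = good , Uniqueₚ.filter⁺ good? (combinations-unique n r) ,
          All.zipWith (λ { (size , none) → size , dense size none })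
            (Allₚ.filter⁺ good? (combinations-size n r) , Allₚ.all-filter good? (combinations n r)) , enough
      collect : Ceiling → MostDense (suc k) p q n r m
      collect (t , r≤qt , least) =
        let ℓ , covers , le = few-bad t (least r (m≤n*m r q {{>-nonZero 1≤q}})) r≤n
        in all-good t r≤qt least ℓ covers le

  sparse-Sárközy : ∀ k p q → 1 ≤ p → 1 ≤ q → Σ ℕ λ B → (1 ≤ B) × (∀ m → Σ ℕ λ N → ∀ n → N ≤ n → ∀ r →
    B ^ suc (suc k) * n ^ suc k ≤ r ^ suc (suc k) → r ≤ n → MostDense (suc (suc k)) p q n r m)
  sparse-Sárközy k₂ p q 1≤p 1≤q = B , 1≤B , λ m → N m , λ n N≤n r large r≤n → conclude m n N≤n r large r≤n
    where
    k₁ = suc k₂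
    k = suc k₁
    A = 32 ^ q
    c = 4 * A
    1≤A : 1 ≤ A
    1≤A = m^n>0 32 q
    1≤c : 1 ≤ c
    1≤c = ≤-trans 1≤A (m≤n*m A 4)
    N₀ = proj₁ (Sárközy k₁ c 1≤c)
    1≤N₀ = proj₁ (proj₂ (Sárközy k₁ c 1≤c))
    rec = proj₂ (proj₂ (Sárközy k₁ c 1≤c))
    -- With this choice `gap` is (G β)^k, so β can be about n^(1/k)/G. The 4 in B = 4 A G is 2 from
    -- `degree` times 2 from rounding β.
    G = c * (N₀ * N₀) * N₀
    1≤G : 1 ≤ G
    1≤G = *-mono-≤ (*-mono-≤ 1≤c (*-mono-≤ 1≤N₀ 1≤N₀)) 1≤N₀
    B = 4 * A * G
    1≤B : 1 ≤ B
    1≤B = *-mono-≤ 1≤c 1≤G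
    -- `A` makes m₀ positive, `G ^ k` makes β = 1 admissible, and (m + 1)^k forces r > m.
    N : ℕ → ℕ
    N m = A + (G ^ k + suc m ^ k)
    conclude : ∀ m n → n ≥ N m → ∀ r → B ^ k * n ^ k₁ ≤ r ^ k → r ≤ n → MostDense k p q n r m
    conclude m n N≤n r large r≤n = finish
      (last-true (λ b → (G * b) ^ k ≤ n) (λ b → (G * b) ^ k ≤? n)
        (subst (λ z → z ^ k ≤ n) (sym (*-identityʳ G)) G^k≤n) n
        (λ le → <⇒≱ (n<1+n n) (≤-trans (≤-trans (n≤n^[1+k] (suc n) k₁ (s≤s z≤n)) (^-monoˡ-≤ k (m≤n*m (suc n) G {{>-nonZero 1≤G}}))) le)))
      where
      A≤n : A ≤ n
      A≤n = ≤-trans (m≤m+n A _) N≤n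
      G^k≤n : G ^ k ≤ n
      G^k≤n = ≤-trans (m≤m+n (G ^ k) _) (≤-trans (m≤n+m _ A) N≤n)
      1≤n : 1 ≤ n
      1≤n = ≤-trans 1≤A A≤n
      m<r : suc m ≤ r
      m<r = ^-cancelˡ-≤ k₁ (begin
        suc m ^ k             ≤⟨ ≤-trans (m≤n+m (suc m ^ k) (G ^ k)) (≤-trans (m≤n+m _ A) N≤n) ⟩
        n                     ≤⟨ n≤n^[1+k] n k₂ 1≤n ⟩
        n ^ k₁                ≤⟨ m≤n*m (n ^ k₁) (B ^ k) {{m^n≢0 B k {{>-nonZero 1≤B}}}} ⟩
        B ^ k * n ^ k₁        ≤⟨ large ⟩
        r ^ k                 ∎)
        where open ≤-Reasoning
      finish : (Σ ℕ λ b → (1 ≤ b) × ((G * b) ^ k ≤ n) × ¬ ((G * suc b) ^ k ≤ n)) → MostDense k p q n r m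
      finish (β , 1≤β , le , nle) = Sparse.mostDense k₁ A N₀ 1≤A 1≤N₀ rec n r β A≤n 1≤β
        (subst (λ z → z ^ k ≤ n) (eq₀ (c * (N₀ * N₀)) N₀ β) le) degree p q m 1≤p 1≤q refl (<⇒≤ m<r) r≤n
        where
        open ≤-Reasoning
        eq₀ : ∀ a b c → a * b * c ≡ a * c * b
        eq₀ = solve-∀
        eq₁ : ∀ x y z → x * (z * y) ≡ z * (x * y)
        eq₁ = solve-∀
        n≤[2Gβ]^k : n ≤ (2 * G * β) ^ k
        n≤[2Gβ]^k = ≤-trans (<⇒≤ (≰⇒> nle)) (^-monoˡ-≤ k (begin
          G * suc β       ≤⟨ *-monoʳ-≤ G (+-monoˡ-≤ β 1≤β) ⟩
          G * (β + β)     ≡⟨ eq G β ⟩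
          2 * G * β       ∎))
          where
          eq : ∀ G b → G * (b + b) ≡ 2 * G * b
          eq = solve-∀
        -- Multiplying `large` by n ≤ (2 G β)^k makes both sides perfect k-th powers, so roots can
        -- be taken within ℕ.
        scaled : B * n ≤ r * (2 * G * β)
        scaled = ^-cancelˡ-≤ k₁ (begin
          (B * n) ^ k                  ≡⟨ ^-distribʳ-* B n k ⟩
          B ^ k * (n * n ^ k₁)         ≡⟨ eq₁ (B ^ k) (n ^ k₁) n ⟩
          n * (B ^ k * n ^ k₁)         ≤⟨ *-mono-≤ n≤[2Gβ]^k large ⟩
          (2 * G * β) ^ k * r ^ k      ≡⟨ trans (*-comm ((2 * G * β) ^ k) (r ^ k)) (sym (^-distribʳ-* r (2 * G * β) k)) ⟩
          (r * (2 * G * β)) ^ k        ∎)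
        degree : 2 * A * n ≤ r * β
        degree = *-cancelˡ-≤ (2 * G) {{m*n≢0 2 G {{_}} {{>-nonZero 1≤G}}}} (begin
          2 * G * (2 * A * n)     ≡⟨ eq₂ G A n ⟩
          4 * A * G * n           ≤⟨ scaled ⟩
          r * (2 * G * β)         ≡⟨ eq₃ r G β ⟩
          2 * G * (r * β)         ∎)
          where
          eq₂ : ∀ G A n → 2 * G * (2 * A * n) ≡ 4 * A * G * n
          eq₂ = solve-∀
          eq₃ : ∀ r G b → r * (2 * G * b) ≡ 2 * G * (r * b)
          eq₃ = solve-∀

open import Defs
open import Data.Nat using (ℕ; zero; suc; s≤s; _*_; _∸_; _^_; _≤_; _≥_)
open import Data.Product using (Σ; _×_)

mainTheorem1 : (k : ℕ) → k ≥ 2 → (p q : ℕ) → p ≥ 1 → q ≥ 1 →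
    Σ ℕ λ C → (C ≥ 1) ×
    ((m : ℕ) → Σ ℕ λ N → (n : ℕ) → n ≥ N → (r : ℕ) →
    C ^ k * n ^ (k ∸ 1) ≤ r ^ k → r ≤ n →
    MostDense k p q n r m)
mainTheorem1 (suc (suc k)) _        = SparseSets.sparse-Sárközy k
mainTheorem1 (suc zero)    (s≤s ())
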